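{- Let $G$ be a finite simple graph with $n$ vertices and minimum degree $\delta \ge 10^6$. Then $$\gamma_s(G) \le \frac{\sqrt{6\ln(\delta+1)} + 1.21}{\sqrt{\delta+1}}\, n.$$
   Context: For a vertex $v$ of $G$, $N[v]$ denotes the closed neighbourhood of $v$ (i.e. $v$ together with its neighbours). A signed domination function of $G$ is a function $f: V(G) \to \{ -1, 1\}$ such that $\sum_{x \in N[v]} f(x) \ge 1$ for every vertex $v \in V(G)$. The weight of $f$ is $f(V(G)) = \sum_{v \in V(G)} f(v)$. The signed domination number $\gamma_s(G)$ is the minimum weight of a signed domination function of $G$. -}

module Defs where

open import Data.Nat as ℕ using (ℕ; zero; suc)
import Data.Nat.Properties as ℕ
open import Data.List as List using (List)
import Data.Nat.Solver as ℕ
open import Data.Integer as ℤ using (ℤ; +_; -[1+_]; 0ℤ; 1ℤ)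
import Data.Integer.Properties as ℤ
open import Data.Rational as ℚ using (ℚ; mkℚ; 0ℚ; 1ℚ; ½; toℚᵘ; ∣_∣; _⊔_)
import Data.Rational.Properties as ℚ
open import Data.Rational.Literals using (fromℤ)
open import Data.Rational.Solver using (module +-*-Solver)
open import Data.Rational.Unnormalised as ℚᵘ using (mkℚᵘ; *≡*)
import Data.Rational.Unnormalised.Properties as ℚᵘ
open import Data.Fin as Fin using (Fin)
import Data.Fin.Properties as Fin
open import Data.List.Extrema ℤ.≤-totalOrder using (argmin; argmin-all; f[argmin]≤v⁺)
open import Data.List.Membership.Propositional using (find; lose)
open import Data.List.Membership.Propositional.Properties using (∈-filter⁺; ∈-allFin; ∈-length)
import Data.List.Relation.Unary.All.Properties as All
open import Data.List.Relation.Unary.Any as Any using (Any; here)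
import Data.List.Relation.Unary.Any.Properties as Any
open import Data.Sign as Sign using (Sign)
import Data.Vec.Functional as Vec
open import Level using (0ℓ)
open import Data.Product using (∃-syntax; _×_; _,_; proj₁; proj₂)
open import Data.Sum using (_⊎_; inj₁; inj₂)
open import Relation.Nullary using (¬_; yes; no; contradiction)
open import Relation.Nullary.Decidable using (_⊎-dec_)
import Relation.Unary as Unary
open import Relation.Binary using (Rel; Decidable; Symmetric; Irreflexive)
open import Relation.Binary.PropositionalEquality
  using (_≡_; _≗_; refl; sym; trans; cong; cong₂; subst; module ≡-Reasoning)
open ℕ.+-*-Solver using ()
  renaming (con to ℕ-con; _:+_ to _:+ℕ_; _:*_ to _:*ℕ_; _:=_ to _:=ℕ_)
open +-*-Solver using (solve; con; _:+_; _:*_; _:-_; :-_; _:=_)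

fromℕ : ℕ → ℚ
fromℕ n = fromℤ (+ n)

inv : ℕ → ℚ
inv n = ℚ.1/ fromℕ (suc n)

fromℕ-suc : ∀ n → fromℕ (suc n) ≡ 1ℚ ℚ.+ fromℕ n
fromℕ-suc n = ℚ.toℚᵘ-injective (begin
  mkℚᵘ (+ suc n) 0                  ≈⟨ *≡* (cong (λ k → (+ 1 ℤ.+ k) ℤ.* + 1) (sym (ℤ.*-identityʳ (+ n)))) ⟩
  ℚᵘ.1ℚᵘ ℚᵘ.+ mkℚᵘ (+ n) 0          ≈⟨ ℚᵘ.≃-sym (ℚ.toℚᵘ-homo-+ 1ℚ (fromℕ n)) ⟩
  toℚᵘ (1ℚ ℚ.+ fromℕ n)             ∎)
  where open ℚᵘ.≃-Reasoning

fromℕ-mono-≤ : ∀ {m n} → m ℕ.≤ n → fromℕ m ℚ.≤ fromℕ n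
fromℕ-mono-≤ m≤n = ℚ.*≤* (ℤ.*-monoʳ-≤-nonNeg (+ 1) (ℤ.+≤+ m≤n))

fromℕ-nonNeg : ∀ n → 0ℚ ℚ.≤ fromℕ n
fromℕ-nonNeg n = fromℕ-mono-≤ {0} {n} ℕ.z≤n

inv-anti-≤ : ∀ {m n} → m ℕ.≤ n → inv n ℚ.≤ inv m
inv-anti-≤ m≤n = ℚ.*≤* (ℤ.*-monoˡ-≤-nonNeg (+ 1) (ℤ.+≤+ (ℕ.s≤s m≤n)))

inv-pos : ∀ n → 0ℚ ℚ.< inv n
inv-pos n = ℚ.positive⁻¹ (inv n)

-- suc (k + r * suc k) is (r+1)(k+1), so this is (k+1) · 1/((r+1)(k+1)) = 1/(r+1).
fromℕ*inv : ∀ k r → fromℕ (suc k) ℚ.* inv (k ℕ.+ r ℕ.* suc k) ≡ inv r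
fromℕ*inv k r = ℚ.toℚᵘ-injective (begin
  toℚᵘ (fromℕ (suc k) ℚ.* inv q)            ≈⟨ ℚ.toℚᵘ-homo-* (fromℕ (suc k)) (inv q) ⟩
  mkℚᵘ (+ suc k) 0 ℚᵘ.* mkℚᵘ (+ 1) q        ≈⟨ *≡* (cong +_ eq) ⟩
  mkℚᵘ (+ 1) r                              ∎)
  where
  open ℚᵘ.≃-Reasoning
  q = k ℕ.+ r ℕ.* suc k
  eq : suc k ℕ.* 1 ℕ.* suc r ≡ 1 ℕ.* (1 ℕ.* (suc r ℕ.* suc k))
  eq = ℕ.+-*-Solver.solve 2 (λ k r → (ℕ-con 1 :+ℕ k) :*ℕ ℕ-con 1 :*ℕ (ℕ-con 1 :+ℕ r)
    :=ℕ ℕ-con 1 :*ℕ (ℕ-con 1 :*ℕ ((ℕ-con 1 :+ℕ r) :*ℕ (ℕ-con 1 :+ℕ k)))) refl k r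

archimedean : ∀ {ε} → 0ℚ ℚ.< ε → ∃[ N ] inv N ℚ.≤ ε
archimedean {ε} 0<ε with ℚ.positive 0<ε
archimedean {mkℚ ℤ.+[1+ p ] d _} 0<ε | _ = d ,
  ℚ.*≤* (ℤ.*-monoʳ-≤-nonNeg (+ suc d) (ℤ.+≤+ (ℕ.s≤s (ℕ.z≤n {p}))))

*-mono-≤ : ∀ {a b c d} → 0ℚ ℚ.≤ a → 0ℚ ℚ.≤ d → a ℚ.≤ b → c ℚ.≤ d → a ℚ.* c ℚ.≤ b ℚ.* d
*-mono-≤ {a} {b} {c} {d} 0≤a 0≤d a≤b c≤d = ℚ.≤-trans
  (ℚ.*-monoˡ-≤-nonNeg a {{ℚ.nonNegative 0≤a}} c≤d)
  (ℚ.*-monoʳ-≤-nonNeg d {{ℚ.nonNegative 0≤d}} a≤b)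

*-pos : ∀ {p q} → 0ℚ ℚ.< p → 0ℚ ℚ.< q → 0ℚ ℚ.< p ℚ.* q
*-pos {p} {q} 0<p 0<q =
  ℚ.positive⁻¹ (p ℚ.* q) {{ℚ.pos*pos⇒pos p {{ℚ.positive 0<p}} q {{ℚ.positive 0<q}}}}

*-nonNeg : ∀ {p q} → 0ℚ ℚ.≤ p → 0ℚ ℚ.≤ q → 0ℚ ℚ.≤ p ℚ.* q
*-nonNeg {p} {q} 0≤p 0≤q = ℚ.nonNegative⁻¹ (p ℚ.* q)
  {{ℚ.nonNeg*nonNeg⇒nonNeg p {{ℚ.nonNegative 0≤p}} q {{ℚ.nonNegative 0≤q}}}}

recip : ∀ p → 0ℚ ℚ.< p → ℚ
recip p 0<p = (ℚ.1/ p) {{ℚ.pos⇒nonZero p {{ℚ.positive 0<p}}}}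

recip-pos : ∀ p (0<p : 0ℚ ℚ.< p) → 0ℚ ℚ.< recip p 0<p
recip-pos p 0<p = ℚ.positive⁻¹ (recip p 0<p) {{ℚ.1/pos⇒pos p {{ℚ.positive 0<p}}}}

*-recip : ∀ p (0<p : 0ℚ ℚ.< p) → p ℚ.* recip p 0<p ≡ 1ℚ
*-recip p 0<p = ℚ.*-inverseʳ p {{ℚ.pos⇒nonZero p {{ℚ.positive 0<p}}}}

p-q≤r⇒p≤q+r : ∀ {p q r} → p ℚ.- q ℚ.≤ r → p ℚ.≤ q ℚ.+ r
p-q≤r⇒p≤q+r {p} {q} {r} p-q≤r = subst (ℚ._≤ q ℚ.+ r)
  (solve 2 (λ p q → q :+ (p :- q) := p) refl p q) (ℚ.+-monoʳ-≤ q p-q≤r)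

p≤q+r⇒p-q≤r : ∀ {p q r} → p ℚ.≤ q ℚ.+ r → p ℚ.- q ℚ.≤ r
p≤q+r⇒p-q≤r {p} {q} {r} p≤q+r = subst (p ℚ.- q ℚ.≤_)
  (solve 2 (λ q r → q :+ r :- q := r) refl q r) (ℚ.+-monoˡ-≤ (ℚ.- q) p≤q+r)

p≤∣p∣ : ∀ p → p ℚ.≤ ∣ p ∣
p≤∣p∣ p with ℚ.≤-total 0ℚ p
... | inj₁ 0≤p = ℚ.≤-reflexive (sym (ℚ.0≤p⇒∣p∣≡p 0≤p))
... | inj₂ p≤0 = ℚ.≤-trans p≤0 (ℚ.0≤∣p∣ p)

∣p-q∣≤r⇒p≤q+r : ∀ {p q r} → ∣ p ℚ.- q ∣ ℚ.≤ r → p ℚ.≤ q ℚ.+ r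
∣p-q∣≤r⇒p≤q+r {p} {q} h = p-q≤r⇒p≤q+r (ℚ.≤-trans (p≤∣p∣ (p ℚ.- q)) h)

∣p-q∣-intro : ∀ {p q r} → p ℚ.≤ q ℚ.+ r → q ℚ.≤ p ℚ.+ r → ∣ p ℚ.- q ∣ ℚ.≤ r
∣p-q∣-intro {p} {q} {r} h₁ h₂ with ℚ.∣p∣≡p∨∣p∣≡-p (p ℚ.- q)
... | inj₁ eq = subst (ℚ._≤ r) (sym eq) (p≤q+r⇒p-q≤r h₁)
... | inj₂ eq = subst (ℚ._≤ r)
  (trans (solve 2 (λ p q → q :- p := :- (p :- q)) refl p q) (sym eq)) (p≤q+r⇒p-q≤r h₂)

½-split : ∀ ε → ½ ℚ.* ε ℚ.+ ½ ℚ.* ε ≡ ε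
½-split ε = trans (sym (ℚ.*-distribʳ-+ ε ½ ½)) (ℚ.*-identityˡ ε)

½-pos : ∀ {ε} → 0ℚ ℚ.< ε → 0ℚ ℚ.< ½ ℚ.* ε
½-pos = *-pos (ℚ.positive⁻¹ ½)

IsCauchy : (ℕ → ℚ) → Set
IsCauchy x = ∀ ε → 0ℚ ℚ.< ε →
  ∃[ N ] (∀ m n → N ℕ.≤ m → N ℕ.≤ n → ∣ x m ℚ.- x n ∣ ℚ.≤ ε)

record ℝ : Set where
  no-eta-equality
  constructor mkℝ
  field
    seq    : ℕ → ℚ
    cauchy : IsCauchy seq

open ℝ public

infix  4 _≤ᴿ_
infixl 6 _+ᴿ_
infixl 7 _*ᴿ_ _÷ᴿ_

_≤ᴿ_ : ℝ → ℝ → Set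
x ≤ᴿ y = ∀ ε → 0ℚ ℚ.< ε →
  ∃[ N ] (∀ n → N ℕ.≤ n → seq x n ℚ.≤ seq y n ℚ.+ ε)

cauchy-intro : ∀ {x} →
  (∀ ε → 0ℚ ℚ.< ε → ∃[ N ] (∀ m n → N ℕ.≤ m → N ℕ.≤ n → x m ℚ.≤ x n ℚ.+ ε)) → IsCauchy x
cauchy-intro h ε 0<ε with h ε 0<ε
... | N , p = N , λ m n N≤m N≤n → ∣p-q∣-intro (p m n N≤m N≤n) (p n m N≤n N≤m)

fromℚ : ℚ → ℝ
fromℚ q .seq _ = q
fromℚ q .cauchy ε 0<ε = 0 , λ _ _ _ _ →
  subst (ℚ._≤ ε) (sym (cong ∣_∣ (ℚ.+-inverseʳ q))) (ℚ.<⇒≤ 0<ε)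

fromℤᴿ : ℤ → ℝ
fromℤᴿ i = fromℚ (fromℤ i)

fromℕᴿ : ℕ → ℝ
fromℕᴿ n = fromℚ (fromℕ n)

_+ᴿ_ : ℝ → ℝ → ℝ
(x +ᴿ y) .seq n = seq x n ℚ.+ seq y n
(x +ᴿ y) .cauchy ε 0<ε with cauchy x (½ ℚ.* ε) (½-pos 0<ε) | cauchy y (½ ℚ.* ε) (½-pos 0<ε)
... | M , p | N , q = M ℕ.⊔ N , λ m n h₁ h₂ → begin
  ∣ (seq x m ℚ.+ seq y m) ℚ.- (seq x n ℚ.+ seq y n) ∣
    ≡⟨ cong ∣_∣ (solve 4 (λ a b c d → (a :+ b) :- (c :+ d) := (a :- c) :+ (b :- d)) refl
         (seq x m) (seq y m) (seq x n) (seq y n)) ⟩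
  ∣ (seq x m ℚ.- seq x n) ℚ.+ (seq y m ℚ.- seq y n) ∣
    ≤⟨ ℚ.∣p+q∣≤∣p∣+∣q∣ (seq x m ℚ.- seq x n) (seq y m ℚ.- seq y n) ⟩
  ∣ seq x m ℚ.- seq x n ∣ ℚ.+ ∣ seq y m ℚ.- seq y n ∣
    ≤⟨ ℚ.+-mono-≤ (p m n (ℕ.m⊔n≤o⇒m≤o M N h₁) (ℕ.m⊔n≤o⇒m≤o M N h₂))
                  (q m n (ℕ.m⊔n≤o⇒n≤o M N h₁) (ℕ.m⊔n≤o⇒n≤o M N h₂)) ⟩
  ½ ℚ.* ε ℚ.+ ½ ℚ.* ε
    ≡⟨ ½-split ε ⟩
  ε ∎
  where open ℚ.≤-Reasoning

bounded : ∀ x → ∃[ B ] 0ℚ ℚ.< B × ∃[ N ] (∀ n → N ℕ.≤ n → ∣ seq x n ∣ ℚ.≤ B)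
bounded x with cauchy x 1ℚ (ℚ.positive⁻¹ 1ℚ)
... | N , p = 1ℚ ℚ.+ ∣ seq x N ∣
            , ℚ.+-mono-<-≤ (ℚ.positive⁻¹ 1ℚ) (ℚ.0≤∣p∣ (seq x N))
            , N , λ n N≤n → begin
  ∣ seq x n ∣
    ≡⟨ cong ∣_∣ (solve 2 (λ a b → a := (a :- b) :+ b) refl (seq x n) (seq x N)) ⟩
  ∣ (seq x n ℚ.- seq x N) ℚ.+ seq x N ∣
    ≤⟨ ℚ.∣p+q∣≤∣p∣+∣q∣ (seq x n ℚ.- seq x N) (seq x N) ⟩
  ∣ seq x n ℚ.- seq x N ∣ ℚ.+ ∣ seq x N ∣
    ≤⟨ ℚ.+-monoˡ-≤ ∣ seq x N ∣ (p n N N≤n ℕ.≤-refl) ⟩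
  1ℚ ℚ.+ ∣ seq x N ∣ ∎
  where open ℚ.≤-Reasoning

absorb : ∀ {C} e (0<C : 0ℚ ℚ.< C) → C ℚ.* (e ℚ.* recip C 0<C) ≡ e
absorb {C} e 0<C = begin
  C ℚ.* (e ℚ.* recip C 0<C)    ≡⟨ solve 3 (λ c e r → c :* (e :* r) := e :* (c :* r)) refl C e (recip C 0<C) ⟩
  e ℚ.* (C ℚ.* recip C 0<C)    ≡⟨ cong (e ℚ.*_) (*-recip C 0<C) ⟩
  e ℚ.* 1ℚ                     ≡⟨ ℚ.*-identityʳ e ⟩
  e                            ∎
  where open ≡-Reasoning

*-close : ∀ {a b c d A D η θ} → ∣ a ∣ ℚ.≤ A → ∣ d ∣ ℚ.≤ D → ∣ b ℚ.- d ∣ ℚ.≤ η → ∣ a ℚ.- c ∣ ℚ.≤ θ →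
  ∣ a ℚ.* b ℚ.- c ℚ.* d ∣ ℚ.≤ A ℚ.* η ℚ.+ D ℚ.* θ
*-close {a} {b} {c} {d} {A} {D} {η} {θ} ha hd hη hθ = begin
  ∣ a ℚ.* b ℚ.- c ℚ.* d ∣
    ≡⟨ cong ∣_∣ (solve 4 (λ a b c d → a :* b :- c :* d := a :* (b :- d) :+ d :* (a :- c)) refl a b c d) ⟩
  ∣ a ℚ.* (b ℚ.- d) ℚ.+ d ℚ.* (a ℚ.- c) ∣
    ≤⟨ ℚ.∣p+q∣≤∣p∣+∣q∣ (a ℚ.* (b ℚ.- d)) (d ℚ.* (a ℚ.- c)) ⟩
  ∣ a ℚ.* (b ℚ.- d) ∣ ℚ.+ ∣ d ℚ.* (a ℚ.- c) ∣
    ≡⟨ cong₂ ℚ._+_ (ℚ.∣p*q∣≡∣p∣*∣q∣ a (b ℚ.- d)) (ℚ.∣p*q∣≡∣p∣*∣q∣ d (a ℚ.- c)) ⟩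
  ∣ a ∣ ℚ.* ∣ b ℚ.- d ∣ ℚ.+ ∣ d ∣ ℚ.* ∣ a ℚ.- c ∣
    ≤⟨ ℚ.+-mono-≤
         (*-mono-≤ (ℚ.0≤∣p∣ a) (ℚ.≤-trans (ℚ.0≤∣p∣ (b ℚ.- d)) hη) ha hη)
         (*-mono-≤ (ℚ.0≤∣p∣ d) (ℚ.≤-trans (ℚ.0≤∣p∣ (a ℚ.- c)) hθ) hd hθ) ⟩
  A ℚ.* η ℚ.+ D ℚ.* θ ∎
  where open ℚ.≤-Reasoning

_*ᴿ_ : ℝ → ℝ → ℝ
(x *ᴿ y) .seq n = seq x n ℚ.* seq y n
(x *ᴿ y) .cauchy ε 0<ε =
  let A , 0<A , K , a = bounded x
      B , 0<B , L , b = bounded y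
      M , p = cauchy x (½ ℚ.* ε ℚ.* recip B 0<B) (*-pos (½-pos 0<ε) (recip-pos B 0<B))
      N , q = cauchy y (½ ℚ.* ε ℚ.* recip A 0<A) (*-pos (½-pos 0<ε) (recip-pos A 0<A))
  in (K ℕ.⊔ L) ℕ.⊔ (M ℕ.⊔ N) , λ m n h₁ h₂ →
  let K≤m = ℕ.m⊔n≤o⇒m≤o K L (ℕ.m⊔n≤o⇒m≤o (K ℕ.⊔ L) (M ℕ.⊔ N) h₁)
      L≤n = ℕ.m⊔n≤o⇒n≤o K L (ℕ.m⊔n≤o⇒m≤o (K ℕ.⊔ L) (M ℕ.⊔ N) h₂)
      MN≤m = ℕ.m⊔n≤o⇒n≤o (K ℕ.⊔ L) (M ℕ.⊔ N) h₁
      MN≤n = ℕ.m⊔n≤o⇒n≤o (K ℕ.⊔ L) (M ℕ.⊔ N) h₂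
  in subst (∣ seq x m ℚ.* seq y m ℚ.- seq x n ℚ.* seq y n ∣ ℚ.≤_)
       (trans (cong₂ ℚ._+_ (absorb (½ ℚ.* ε) 0<A) (absorb (½ ℚ.* ε) 0<B)) (½-split ε))
       (*-close {seq x m} {seq y m} {seq x n} {seq y n} (a m K≤m) (b n L≤n)
         (q m n (ℕ.m⊔n≤o⇒n≤o M N MN≤m) (ℕ.m⊔n≤o⇒n≤o M N MN≤n))
         (p m n (ℕ.m⊔n≤o⇒m≤o M N MN≤m) (ℕ.m⊔n≤o⇒m≤o M N MN≤n)))

record Positive (x : ℝ) : Set where
  no-eta-equality
  field
    bound     : ℚ
    bound>0   : 0ℚ ℚ.< bound
    threshold : ℕ
    bounds    : ∀ n → threshold ℕ.≤ n → bound ℚ.≤ seq x n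

open Positive public

instance
  fromℕ-positive : ∀ {n} → Positive (fromℕᴿ (suc n))
  fromℕ-positive .bound = 1ℚ
  fromℕ-positive .bound>0 = ℚ.positive⁻¹ 1ℚ
  fromℕ-positive .threshold = 0
  fromℕ-positive .bounds _ _ = fromℕ-mono-≤ (ℕ.s≤s ℕ.z≤n)

⊔-pos : ∀ p {q} → 0ℚ ℚ.< q → 0ℚ ℚ.< p ⊔ q
⊔-pos p {q} 0<q = ℚ.<-≤-trans 0<q (ℚ.p≤q⊔p p q)

⊔-mono-+ : ∀ {p q ε} c → 0ℚ ℚ.≤ ε → p ℚ.≤ q ℚ.+ ε → p ⊔ c ℚ.≤ (q ⊔ c) ℚ.+ ε
⊔-mono-+ {p} {q} {ε} c 0≤ε h = ℚ.⊔-lub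
  (ℚ.≤-trans h (ℚ.+-monoˡ-≤ ε (ℚ.p≤p⊔q q c)))
  (subst (ℚ._≤ (q ⊔ c) ℚ.+ ε) (ℚ.+-identityʳ c) (ℚ.+-mono-≤ (ℚ.p≤q⊔p q c) 0≤ε))

recip-close : ∀ {a b c ε} (0<a : 0ℚ ℚ.< a) (0<b : 0ℚ ℚ.< b) → 0ℚ ℚ.< c → 0ℚ ℚ.< ε →
  c ℚ.≤ a → c ℚ.≤ b → b ℚ.≤ a ℚ.+ ε ℚ.* (c ℚ.* c) → recip a 0<a ℚ.≤ recip b 0<b ℚ.+ ε
recip-close {a} {b} {c} {ε} 0<a 0<b 0<c 0<ε c≤a c≤b b≤a+εc² = begin
  r                                            ≡⟨ ℚ.*-identityʳ r ⟨
  r ℚ.* 1ℚ                                     ≡⟨ cong (r ℚ.*_) (*-recip b 0<b) ⟨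
  r ℚ.* (b ℚ.* s)                              ≡⟨ solve 3 (λ r b s → r :* (b :* s) := b :* (r :* s)) refl r b s ⟩
  b ℚ.* (r ℚ.* s)                              ≤⟨ ℚ.*-monoʳ-≤-nonNeg (r ℚ.* s) {{ℚ.nonNegative 0≤rs}}
                                                    (ℚ.≤-trans b≤a+εc² (ℚ.+-monoʳ-≤ a εc²≤εab)) ⟩
  (a ℚ.+ ε ℚ.* (a ℚ.* b)) ℚ.* (r ℚ.* s)        ≡⟨ solve 5 (λ a b e r s → (a :+ e :* (a :* b)) :* (r :* s)
                                                    := (a :* r) :* s :+ e :* ((a :* r) :* (b :* s))) refl a b ε r s ⟩
  (a ℚ.* r) ℚ.* s ℚ.+ ε ℚ.* ((a ℚ.* r) ℚ.* (b ℚ.* s))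
                                               ≡⟨ cong₂ (λ u v → u ℚ.* s ℚ.+ ε ℚ.* (u ℚ.* v)) (*-recip a 0<a) (*-recip b 0<b) ⟩
  1ℚ ℚ.* s ℚ.+ ε ℚ.* 1ℚ                        ≡⟨ cong₂ ℚ._+_ (ℚ.*-identityˡ s) (ℚ.*-identityʳ ε) ⟩
  s ℚ.+ ε                                      ∎
  where
  open ℚ.≤-Reasoning
  r = recip a 0<a
  s = recip b 0<b
  0≤rs : 0ℚ ℚ.≤ r ℚ.* s
  0≤rs = ℚ.<⇒≤ (*-pos (recip-pos a 0<a) (recip-pos b 0<b))
  εc²≤εab : ε ℚ.* (c ℚ.* c) ℚ.≤ ε ℚ.* (a ℚ.* b)
  εc²≤εab = ℚ.*-monoˡ-≤-nonNeg ε {{ℚ.nonNegative (ℚ.<⇒≤ 0<ε)}}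
    (*-mono-≤ (ℚ.<⇒≤ 0<c) (ℚ.<⇒≤ 0<b) c≤a c≤b)

-- From the threshold of the witness on, the maximum below is seq x n itself; taking
-- it makes the terms before the threshold invertible too.
_⁻¹ᴿ : (x : ℝ) → {{Positive x}} → ℝ
(x ⁻¹ᴿ) {{x>0}} .seq n = recip (seq x n ⊔ bound x>0) (⊔-pos (seq x n) (bound>0 x>0))
(x ⁻¹ᴿ) {{x>0}} .cauchy = cauchy-intro λ ε 0<ε →
  let c = bound x>0
      0<c = bound>0 x>0
      0<η = *-pos 0<ε (*-pos 0<c 0<c)
      N , p = cauchy x (ε ℚ.* (c ℚ.* c)) 0<η
  in N , λ m n N≤m N≤n →
    recip-close (⊔-pos (seq x m) 0<c) (⊔-pos (seq x n) 0<c) 0<c 0<ε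
      (ℚ.p≤q⊔p (seq x m) c) (ℚ.p≤q⊔p (seq x n) c)
      (⊔-mono-+ {seq x n} {seq x m} c (ℚ.<⇒≤ 0<η) (∣p-q∣≤r⇒p≤q+r (p n m N≤n N≤m)))

_÷ᴿ_ : (x y : ℝ) → {{Positive y}} → ℝ
x ÷ᴿ y = x *ᴿ (y ⁻¹ᴿ)

sq : ℚ → ℚ
sq q = q ℚ.* q

p≤∣↥p∣ : ∀ p → p ℚ.≤ fromℕ ℤ.∣ ℚ.↥ p ∣
p≤∣↥p∣ p@(mkℚ (+ n) d _) =
  ℚ.*≤* (ℤ.*-monoˡ-≤-nonNeg (+ n) (ℤ.+≤+ (ℕ.s≤s (ℕ.z≤n {d}))))
p≤∣↥p∣ p@(mkℚ -[1+ n ] d _) = ℚ.≤-trans (ℚ.<⇒≤ (ℚ.negative⁻¹ p)) (fromℕ-nonNeg (suc n))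

fromℕ-*-inv : ∀ n k → fromℕ (suc n ℕ.* k) ℚ.* inv n ≡ fromℕ k
fromℕ-*-inv n k = ℚ.toℚᵘ-injective (begin
  toℚᵘ (fromℕ (suc n ℕ.* k) ℚ.* inv n)             ≈⟨ ℚ.toℚᵘ-homo-* (fromℕ (suc n ℕ.* k)) (inv n) ⟩
  mkℚᵘ (+ (suc n ℕ.* k)) 0 ℚᵘ.* mkℚᵘ (+ 1) n       ≈⟨ *≡* eq ⟩
  mkℚᵘ (+ k) 0                                     ∎)
  where
  open ℚᵘ.≃-Reasoning
  eq : + (suc n ℕ.* k) ℤ.* + 1 ℤ.* + 1 ≡ + k ℤ.* (+ suc (n ℕ.+ 0))
  eq = trans (ℤ.*-identityʳ (+ (suc n ℕ.* k) ℤ.* + 1)) (trans (ℤ.*-identityʳ (+ (suc n ℕ.* k)))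
         (trans (ℤ.pos-* (suc n) k) (trans (ℤ.*-comm (+ suc n) (+ k))
           (cong (λ j → + k ℤ.* + suc j) (sym (ℕ.+-identityʳ n))))))

-- The largest r < K with (r/(n+1))² ≤ a; it exists when 0 ≤ a and K > 0.
√-search : ℕ → ℚ → ℕ → ℕ
√-search n a zero = 0
√-search n a (suc r) with sq (fromℕ r ℚ.* inv n) ℚ.≤? a
... | yes _ = r
... | no  _ = √-search n a r

√-search-lower : ∀ n {a} → 0ℚ ℚ.≤ a → ∀ K → sq (fromℕ (√-search n a K) ℚ.* inv n) ℚ.≤ a
√-search-lower n {a} 0≤a zero =
  subst (ℚ._≤ a) (sym (cong sq (ℚ.*-zeroˡ (inv n)))) 0≤a
√-search-lower n {a} 0≤a (suc r) with sq (fromℕ r ℚ.* inv n) ℚ.≤? a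
... | yes h = h
... | no  _ = √-search-lower n 0≤a r

√-search-upper : ∀ n {a} → 0ℚ ℚ.≤ a → ∀ K → a ℚ.< sq (fromℕ K ℚ.* inv n) →
  a ℚ.< sq (fromℕ (suc (√-search n a K)) ℚ.* inv n)
√-search-upper n {a} 0≤a zero a<0 = contradiction
  (ℚ.<-≤-trans a<0 (ℚ.≤-trans (ℚ.≤-reflexive (cong sq (ℚ.*-zeroˡ (inv n)))) 0≤a)) (ℚ.<-irrefl refl)
√-search-upper n {a} 0≤a (suc r) h with sq (fromℕ r ℚ.* inv n) ℚ.≤? a
... | yes _ = h
... | no ≰a = √-search-upper n 0≤a r (ℚ.≰⇒> ≰a)

√-bound : ℚ → ℕ
√-bound a = 2 ℕ.+ ℤ.∣ ℚ.↥ a ∣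

a<√-bound² : ∀ a → a ℚ.< sq (fromℕ (√-bound a))
a<√-bound² a = begin-strict
  a                          ≤⟨ p≤∣↥p∣ a ⟩
  fromℕ k                    ≤⟨ fromℕ-mono-≤ (ℕ.n≤1+n k) ⟩
  fromℕ (suc k)              ≡⟨ ℚ.+-identityˡ (fromℕ (suc k)) ⟨
  0ℚ ℚ.+ fromℕ (suc k)       <⟨ ℚ.+-monoˡ-< (fromℕ (suc k)) (ℚ.positive⁻¹ 1ℚ) ⟩
  1ℚ ℚ.+ fromℕ (suc k)       ≡⟨ fromℕ-suc (suc k) ⟨
  fromℕ K                    ≡⟨ ℚ.*-identityˡ (fromℕ K) ⟨
  1ℚ ℚ.* fromℕ K             ≤⟨ *-mono-≤ (ℚ.<⇒≤ (ℚ.positive⁻¹ 1ℚ)) (fromℕ-nonNeg K)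
                                  (fromℕ-mono-≤ {1} {K} (ℕ.s≤s ℕ.z≤n)) ℚ.≤-refl ⟩
  sq (fromℕ K)               ∎
  where
  open ℚ.≤-Reasoning
  k = ℤ.∣ ℚ.↥ a ∣
  K = √-bound a

fromℕ-suc-*-inv : ∀ r n → fromℕ (suc r) ℚ.* inv n ≡ fromℕ r ℚ.* inv n ℚ.+ inv n
fromℕ-suc-*-inv r n = trans (cong (ℚ._* inv n) (fromℕ-suc r))
  (solve 2 (λ p i → (con 1ℚ :+ p) :* i := p :* i :+ i) refl (fromℕ r) (inv n))

-- Opaque only for the sake of type checking; the three lemmas characterise it for 0 ≤ a.
opaque
  √-approx : ℕ → ℚ → ℚ
  √-approx n a = fromℕ (√-search n a (suc n ℕ.* √-bound a)) ℚ.* inv n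

  √-approx-nonNeg : ∀ n a → 0ℚ ℚ.≤ √-approx n a
  √-approx-nonNeg n a =
    *-nonNeg (fromℕ-nonNeg (√-search n a (suc n ℕ.* √-bound a))) (ℚ.<⇒≤ (inv-pos n))

  √-approx-lower : ∀ n {a} → 0ℚ ℚ.≤ a → sq (√-approx n a) ℚ.≤ a
  √-approx-lower n {a} 0≤a = √-search-lower n 0≤a (suc n ℕ.* √-bound a)

  √-approx-upper : ∀ n {a} → 0ℚ ℚ.≤ a → a ℚ.< sq (√-approx n a ℚ.+ inv n)
  √-approx-upper n {a} 0≤a = subst (λ q → a ℚ.< sq q)
    (fromℕ-suc-*-inv (√-search n a (suc n ℕ.* √-bound a)) n)
    (√-search-upper n 0≤a (suc n ℕ.* √-bound a)
      (subst (λ q → a ℚ.< sq q) (sym (fromℕ-*-inv n (√-bound a))) (a<√-bound² a)))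

sq-mono-≤ : ∀ {p q} → 0ℚ ℚ.≤ p → p ℚ.≤ q → sq p ℚ.≤ sq q
sq-mono-≤ 0≤p p≤q = *-mono-≤ 0≤p (ℚ.≤-trans 0≤p p≤q) p≤q p≤q

0≤p⊔0 : ∀ p → 0ℚ ℚ.≤ p ⊔ 0ℚ
0≤p⊔0 p = ℚ.p≤q⊔p p 0ℚ

√-close : ∀ {y z a b e ε} → 0ℚ ℚ.≤ z → 0ℚ ℚ.≤ e → 0ℚ ℚ.< ε → e ℚ.≤ ½ ℚ.* ε →
  sq y ℚ.≤ a → b ℚ.< sq (z ℚ.+ e) → a ℚ.≤ b ℚ.+ sq (½ ℚ.* ε) → y ℚ.≤ z ℚ.+ ε
√-close {y} {z} {a} {b} {e} {ε} 0≤z 0≤e 0<ε e≤½ε y²≤a b<z′² a≤b+ =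
  ℚ.<⇒≤ (ℚ.≰⇒> absurd)
  where
  open ℚ.≤-Reasoning
  η = ½ ℚ.* ε
  0≤η : 0ℚ ℚ.≤ η
  0≤η = ℚ.<⇒≤ (½-pos 0<ε)
  expand : ∀ z η → sq (z ℚ.+ η) ℚ.+ sq η ℚ.+ (η ℚ.+ η) ℚ.* (z ℚ.+ η) ≡ sq (z ℚ.+ (η ℚ.+ η))
  expand = solve 2 (λ z e → (z :+ e) :* (z :+ e) :+ e :* e :+ (e :+ e) :* (z :+ e)
                 := (z :+ (e :+ e)) :* (z :+ (e :+ e))) refl
  absurd : ¬ z ℚ.+ ε ℚ.≤ y
  absurd z+ε≤y = ℚ.<-irrefl refl (begin-strict
    sq (z ℚ.+ ε)                     ≤⟨ sq-mono-≤ (ℚ.+-mono-≤ 0≤z (ℚ.<⇒≤ 0<ε)) z+ε≤y ⟩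
    sq y                             ≤⟨ y²≤a ⟩
    a                                ≤⟨ a≤b+ ⟩
    b ℚ.+ sq η                       <⟨ ℚ.+-monoˡ-< (sq η) b<z′² ⟩
    sq (z ℚ.+ e) ℚ.+ sq η            ≤⟨ ℚ.+-monoˡ-≤ (sq η) (sq-mono-≤ (ℚ.+-mono-≤ 0≤z 0≤e) (ℚ.+-monoʳ-≤ z e≤½ε)) ⟩
    sq (z ℚ.+ η) ℚ.+ sq η            ≡⟨ ℚ.+-identityʳ (sq (z ℚ.+ η) ℚ.+ sq η) ⟨
    sq (z ℚ.+ η) ℚ.+ sq η ℚ.+ 0ℚ     ≤⟨ ℚ.+-monoʳ-≤ (sq (z ℚ.+ η) ℚ.+ sq η)
                                          (*-nonNeg (ℚ.+-mono-≤ 0≤η 0≤η) (ℚ.+-mono-≤ 0≤z 0≤η)) ⟩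
    sq (z ℚ.+ η) ℚ.+ sq η ℚ.+ (η ℚ.+ η) ℚ.* (z ℚ.+ η)
                                     ≡⟨ expand z η ⟩
    sq (z ℚ.+ (η ℚ.+ η))             ≡⟨ cong (λ e → sq (z ℚ.+ e)) (½-split ε) ⟩
    sq (z ℚ.+ ε)                     ∎)

-- Total, with √ x = 0 for x ≤ 0.
√ : ℝ → ℝ
√ x .seq n = √-approx n (seq x n ⊔ 0ℚ)
√ x .cauchy = cauchy-intro λ ε 0<ε →
  let 0<η = ½-pos 0<ε
      0<η² = *-pos 0<η 0<η
      M , p = cauchy x (sq (½ ℚ.* ε)) 0<η²
      N , inv≤η = archimedean 0<η
  in M ℕ.⊔ N , λ m n h₁ h₂ →
    √-close {√-approx m (seq x m ⊔ 0ℚ)} {√-approx n (seq x n ⊔ 0ℚ)}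
      (√-approx-nonNeg n (seq x n ⊔ 0ℚ))
      (ℚ.<⇒≤ (inv-pos n))
      0<ε
      (ℚ.≤-trans (inv-anti-≤ (ℕ.m⊔n≤o⇒n≤o M N h₂)) inv≤η)
      (√-approx-lower m (0≤p⊔0 (seq x m)))
      (√-approx-upper n (0≤p⊔0 (seq x n)))
      (⊔-mono-+ {seq x m} {seq x n} 0ℚ (ℚ.<⇒≤ 0<η²)
        (∣p-q∣≤r⇒p≤q+r (p m n (ℕ.m⊔n≤o⇒m≤o M N h₁) (ℕ.m⊔n≤o⇒m≤o M N h₂))))

√-positive-bound : ∀ {y a c e i} → c ℚ.≤ a → 0ℚ ℚ.≤ y → 0ℚ ℚ.≤ i → a ℚ.< sq (y ℚ.+ i) →
  i ℚ.≤ e → sq (e ℚ.+ e) ℚ.≤ c → e ℚ.≤ y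
√-positive-bound {y} {a} {c} {e} {i} c≤a 0≤y 0≤i a<y′² i≤e 4e²≤c = ℚ.≮⇒≥ λ y<e →
  ℚ.<-irrefl refl (begin-strict
    a                  <⟨ a<y′² ⟩
    sq (y ℚ.+ i)       ≤⟨ sq-mono-≤ (ℚ.+-mono-≤ 0≤y 0≤i) (ℚ.+-mono-≤ (ℚ.<⇒≤ y<e) i≤e) ⟩
    sq (e ℚ.+ e)       ≤⟨ 4e²≤c ⟩
    c                  ≤⟨ c≤a ⟩
    a                  ∎)
  where open ℚ.≤-Reasoning

⊓-pos : ∀ {p q} → 0ℚ ℚ.< p → 0ℚ ℚ.< q → 0ℚ ℚ.< p ℚ.⊓ q
⊓-pos {p} {q} 0<p 0<q with ℚ.⊓-sel p q
... | inj₁ eq = subst (0ℚ ℚ.<_) (sym eq) 0<p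
... | inj₂ eq = subst (0ℚ ℚ.<_) (sym eq) 0<q

instance
  √-positive : ∀ {x} {{_ : Positive x}} → Positive (√ x)
  √-positive {x} {{x>0}} = record
    { bound     = e
    ; bound>0   = 0<e
    ; threshold = threshold x>0 ℕ.⊔ proj₁ N
    ; bounds    = λ n h → √-positive-bound
        (ℚ.≤-trans (bounds x>0 n (ℕ.m⊔n≤o⇒m≤o (threshold x>0) (proj₁ N) h)) (ℚ.p≤p⊔q (seq x n) 0ℚ))
        (√-approx-nonNeg n (seq x n ⊔ 0ℚ))
        (ℚ.<⇒≤ (inv-pos n))
        (√-approx-upper n (0≤p⊔0 (seq x n)))
        (ℚ.≤-trans (inv-anti-≤ (ℕ.m⊔n≤o⇒n≤o (threshold x>0) (proj₁ N) h)) (proj₂ N))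
        4e²≤c
    }
    where
    c = bound x>0
    d = 1ℚ ℚ.⊓ c
    e = ½ ℚ.* d
    0<d : 0ℚ ℚ.< d
    0<d = ⊓-pos (ℚ.positive⁻¹ 1ℚ) (bound>0 x>0)
    0<e : 0ℚ ℚ.< e
    0<e = ½-pos 0<d
    N : ∃[ N ] inv N ℚ.≤ e
    N = archimedean 0<e
    4e²≤c : sq (e ℚ.+ e) ℚ.≤ c
    4e²≤c = ℚ.≤-trans (ℚ.≤-reflexive (cong sq (½-split d)))
      (ℚ.≤-trans (*-mono-≤ (ℚ.<⇒≤ 0<d) (ℚ.<⇒≤ (bound>0 x>0)) (ℚ.p⊓q≤p 1ℚ c) (ℚ.p⊓q≤q 1ℚ c))
                 (ℚ.≤-reflexive (ℚ.*-identityˡ c)))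

sum : ℕ → (ℕ → ℚ) → ℚ
sum zero    f = 0ℚ
sum (suc k) f = sum k f ℚ.+ f k

sum-mono-≤ : ∀ k {f g} → (∀ i → i ℕ.< k → f i ℚ.≤ g i) → sum k f ℚ.≤ sum k g
sum-mono-≤ zero    h = ℚ.≤-refl
sum-mono-≤ (suc k) h = ℚ.+-mono-≤ (sum-mono-≤ k λ i i<k → h i (ℕ.m<n⇒m<1+n i<k)) (h k ℕ.≤-refl)

sum-cong : ∀ k {f g} → f ≗ g → sum k f ≡ sum k g
sum-cong zero    h = refl
sum-cong (suc k) h = cong₂ ℚ._+_ (sum-cong k h) (h k)

sum-const : ∀ k c → sum k (λ _ → c) ≡ fromℕ k ℚ.* c
sum-const zero    c = sym (ℚ.*-zeroˡ c)
sum-const (suc k) c = begin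
  sum k (λ _ → c) ℚ.+ c          ≡⟨ cong (ℚ._+ c) (sum-const k c) ⟩
  fromℕ k ℚ.* c ℚ.+ c            ≡⟨ solve 2 (λ k c → k :* c :+ c := (con 1ℚ :+ k) :* c) refl (fromℕ k) c ⟩
  (1ℚ ℚ.+ fromℕ k) ℚ.* c         ≡⟨ cong (ℚ._* c) (fromℕ-suc k) ⟨
  fromℕ (suc k) ℚ.* c            ∎
  where open ≡-Reasoning

sum-+ : ∀ j k f → sum (j ℕ.+ k) f ≡ sum j f ℚ.+ sum k (λ i → f (j ℕ.+ i))
sum-+ j zero    f = trans (cong (λ l → sum l f) (ℕ.+-identityʳ j)) (sym (ℚ.+-identityʳ (sum j f)))
sum-+ j (suc k) f = begin
  sum (j ℕ.+ suc k) f                                                ≡⟨ cong (λ l → sum l f) (ℕ.+-suc j k) ⟩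
  sum (j ℕ.+ k) f ℚ.+ f (j ℕ.+ k)                                    ≡⟨ cong (ℚ._+ f (j ℕ.+ k)) (sum-+ j k f) ⟩
  sum j f ℚ.+ sum k (λ i → f (j ℕ.+ i)) ℚ.+ f (j ℕ.+ k)              ≡⟨ ℚ.+-assoc (sum j f) _ _ ⟩
  sum j f ℚ.+ (sum k (λ i → f (j ℕ.+ i)) ℚ.+ f (j ℕ.+ k))            ∎
  where open ≡-Reasoning

sum-* : ∀ k t f → sum (k ℕ.* t) f ≡ sum k (λ i → sum t (λ j → f (i ℕ.* t ℕ.+ j)))
sum-* zero    t f = refl
sum-* (suc k) t f = begin
  sum (t ℕ.+ k ℕ.* t) f                                     ≡⟨ cong (λ l → sum l f) (ℕ.+-comm t (k ℕ.* t)) ⟩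
  sum (k ℕ.* t ℕ.+ t) f                                     ≡⟨ sum-+ (k ℕ.* t) t f ⟩
  sum (k ℕ.* t) f ℚ.+ sum t (λ j → f (k ℕ.* t ℕ.+ j))       ≡⟨ cong (ℚ._+ sum t (λ j → f (k ℕ.* t ℕ.+ j))) (sum-* k t f) ⟩
  sum (suc k) (λ i → sum t (λ j → f (i ℕ.* t ℕ.+ j)))       ∎
  where open ≡-Reasoning

-- The right-endpoint Riemann sum of 1/x over [1, 1 + k] with steps of length
-- 1/s, s = n + 1: its terms are (1/s) · 1/(1 + (i+1)/s) = 1/(s + i + 1).
ln-approx : ℕ → ℕ → ℚ
ln-approx k n = sum (k ℕ.* suc n) (λ i → inv (suc n ℕ.+ i))

sum-block : ∀ r t → inv r ≡ sum (suc t) (λ _ → inv (t ℕ.+ r ℕ.* suc t))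
sum-block r t = sym (trans (sum-const (suc t) (inv (t ℕ.+ r ℕ.* suc t))) (fromℕ*inv t r))

-- suc (m + n * suc m) = suc n * suc m, so these compare a mesh with a refinement of it.
module _ (k n m : ℕ) where
  private
    p = m ℕ.+ n ℕ.* suc m

    blocks : ln-approx k p ≡
      sum (k ℕ.* suc n) (λ i → sum (suc m) (λ j → inv (suc p ℕ.+ (i ℕ.* suc m ℕ.+ j))))
    blocks = trans (cong (λ l → sum l (λ i → inv (suc p ℕ.+ i))) (sym (ℕ.*-assoc k (suc n) (suc m))))
                   (sum-* (k ℕ.* suc n) (suc m) (λ i → inv (suc p ℕ.+ i)))

    index : ∀ i j → suc p ℕ.+ (i ℕ.* suc m ℕ.+ j) ≡ j ℕ.+ (suc n ℕ.+ i) ℕ.* suc m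
    index i j = ℕ.+-*-Solver.solve 4 (λ i j n m →
      (ℕ-con 1 :+ℕ (m :+ℕ n :*ℕ (ℕ-con 1 :+ℕ m))) :+ℕ (i :*ℕ (ℕ-con 1 :+ℕ m) :+ℕ j)
        :=ℕ j :+ℕ (ℕ-con 1 :+ℕ n :+ℕ i) :*ℕ (ℕ-con 1 :+ℕ m)) refl i j n m

    index′ : ∀ i j → suc p ℕ.+ (i ℕ.* suc m ℕ.+ j) ≡ suc (m ℕ.+ (n ℕ.+ i) ℕ.* suc m) ℕ.+ j
    index′ i j = ℕ.+-*-Solver.solve 4 (λ i j n m →
      (ℕ-con 1 :+ℕ (m :+ℕ n :*ℕ (ℕ-con 1 :+ℕ m))) :+ℕ (i :*ℕ (ℕ-con 1 :+ℕ m) :+ℕ j)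
        :=ℕ (ℕ-con 1 :+ℕ (m :+ℕ (n :+ℕ i) :*ℕ (ℕ-con 1 :+ℕ m))) :+ℕ j) refl i j n m

    shift : ∀ l → sum l (λ i → inv (n ℕ.+ i)) ℚ.+ inv (n ℕ.+ l) ≡ sum l (λ i → inv (suc n ℕ.+ i)) ℚ.+ inv n
    shift zero    = cong (λ l → 0ℚ ℚ.+ inv l) (ℕ.+-identityʳ n)
    shift (suc l) = begin
      sum l (λ i → inv (n ℕ.+ i)) ℚ.+ inv (n ℕ.+ l) ℚ.+ inv (n ℕ.+ suc l)
        ≡⟨ cong₂ ℚ._+_ (shift l) (cong inv (ℕ.+-suc n l)) ⟩
      sum l (λ i → inv (suc n ℕ.+ i)) ℚ.+ inv n ℚ.+ inv (suc n ℕ.+ l)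
        ≡⟨ swap (sum l (λ i → inv (suc n ℕ.+ i))) (inv n) (inv (suc n ℕ.+ l)) ⟩
      sum l (λ i → inv (suc n ℕ.+ i)) ℚ.+ inv (suc n ℕ.+ l) ℚ.+ inv n ∎
      where
      open ≡-Reasoning
      swap : ∀ a b c → a ℚ.+ b ℚ.+ c ≡ a ℚ.+ c ℚ.+ b
      swap = solve 3 (λ a b c → a :+ b :+ c := a :+ c :+ b) refl

  ln-approx-refine-≥ : ln-approx k n ℚ.≤ ln-approx k p
  ln-approx-refine-≥ = begin
    ln-approx k n
      ≡⟨ sum-cong (k ℕ.* suc n) (λ i → sum-block (suc n ℕ.+ i) m) ⟩
    sum (k ℕ.* suc n) (λ i → sum (suc m) (λ _ → inv (m ℕ.+ (suc n ℕ.+ i) ℕ.* suc m)))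
      ≤⟨ sum-mono-≤ (k ℕ.* suc n) (λ i _ → sum-mono-≤ (suc m) (λ j j<m → inv-anti-≤
           (ℕ.≤-trans (ℕ.≤-reflexive (index i j)) (ℕ.+-monoˡ-≤ _ (ℕ.≤-pred j<m))))) ⟩
    sum (k ℕ.* suc n) (λ i → sum (suc m) (λ j → inv (suc p ℕ.+ (i ℕ.* suc m ℕ.+ j))))
      ≡⟨ blocks ⟨
    ln-approx k p ∎
    where open ℚ.≤-Reasoning

  ln-approx-refine-≤ : ln-approx k p ℚ.≤ ln-approx k n ℚ.+ inv n
  ln-approx-refine-≤ = begin
    ln-approx k p
      ≡⟨ blocks ⟩
    sum (k ℕ.* suc n) (λ i → sum (suc m) (λ j → inv (suc p ℕ.+ (i ℕ.* suc m ℕ.+ j))))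
      ≤⟨ sum-mono-≤ (k ℕ.* suc n) (λ i _ → sum-mono-≤ (suc m) (λ j _ → inv-anti-≤
           (ℕ.≤-trans (ℕ.n≤1+n _) (ℕ.≤-trans (ℕ.m≤m+n _ j) (ℕ.≤-reflexive (sym (index′ i j))))))) ⟩
    sum (k ℕ.* suc n) (λ i → sum (suc m) (λ _ → inv (m ℕ.+ (n ℕ.+ i) ℕ.* suc m)))
      ≡⟨ sum-cong (k ℕ.* suc n) (λ i → sum-block (n ℕ.+ i) m) ⟨
    sum (k ℕ.* suc n) (λ i → inv (n ℕ.+ i))
      ≡⟨ ℚ.+-identityʳ (sum (k ℕ.* suc n) (λ i → inv (n ℕ.+ i))) ⟨
    sum (k ℕ.* suc n) (λ i → inv (n ℕ.+ i)) ℚ.+ 0ℚ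
      ≤⟨ ℚ.+-monoʳ-≤ (sum (k ℕ.* suc n) (λ i → inv (n ℕ.+ i))) (ℚ.<⇒≤ (inv-pos (n ℕ.+ k ℕ.* suc n))) ⟩
    sum (k ℕ.* suc n) (λ i → inv (n ℕ.+ i)) ℚ.+ inv (n ℕ.+ k ℕ.* suc n)
      ≡⟨ shift (k ℕ.* suc n) ⟩
    ln-approx k n ℚ.+ inv n ∎
    where open ℚ.≤-Reasoning

ln-approx-close : ∀ k m n → ln-approx k m ℚ.≤ ln-approx k n ℚ.+ inv n
ln-approx-close k m n = ℚ.≤-trans (ln-approx-refine-≥ k m n)
  (ℚ.≤-trans (ℚ.≤-reflexive (cong (ln-approx k) same)) (ln-approx-refine-≤ k n m))
  where
  same : n ℕ.+ m ℕ.* suc n ≡ m ℕ.+ n ℕ.* suc m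
  same = ℕ.+-*-Solver.solve 2 (λ m n → n :+ℕ m :*ℕ (ℕ-con 1 :+ℕ n)
    :=ℕ m :+ℕ n :*ℕ (ℕ-con 1 :+ℕ m)) refl m n

-- ln m is the integral of 1/x over [1, m].
ln : (m : ℕ) {{_ : ℕ.NonZero m}} → ℝ
ln (suc k) .seq    = ln-approx k
ln (suc k) .cauchy = cauchy-intro λ ε 0<ε →
  let N , inv≤ε = archimedean 0<ε
  in N , λ m n _ N≤n → ℚ.≤-trans (ln-approx-close k m n)
       (ℚ.+-monoʳ-≤ (ln-approx k n) (ℚ.≤-trans (inv-anti-≤ N≤n) inv≤ε))

record Graph (n : ℕ) : Set₁ where
  field
    Adj        : Rel (Fin n) 0ℓ
    adj?       : Decidable Adj
    adj-sym    : Symmetric Adj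
    adj-irrefl : Irreflexive _≡_ Adj

  degree : Fin n → ℕ
  degree v = List.length (List.filter (adj? v) (List.allFin n))

  N[_] : Fin n → List (Fin n)
  N[ v ] = List.filter (λ u → (u Fin.≟ v) ⊎-dec adj? v u) (List.allFin n)

  IsMinDegree : ℕ → Set
  IsMinDegree δ = (∀ v → δ ℕ.≤ degree v) × ∃[ v ] degree v ≡ δ

open Graph public

Signing : ℕ → Set
Signing n = Fin n → Sign

sumOver : ∀ {n} → List (Fin n) → Signing n → ℤ
sumOver xs f = List.foldr (λ x s → (f x ℤ.◃ 1) ℤ.+ s) 0ℤ xs

weight : ∀ {n} → Signing n → ℤ
weight {n} f = sumOver (List.allFin n) f

IsSignedDomination : ∀ {n} → Graph n → Signing n → Set
IsSignedDomination G f = ∀ v → 1ℤ ℤ.≤ sumOver (N[_] G v) f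

isSignedDomination? : ∀ {n} (G : Graph n) → Unary.Decidable (IsSignedDomination G)
isSignedDomination? G f = Fin.all? λ v → 1ℤ ℤ.≤? sumOver (N[_] G v) f

allSignings : ∀ n → List (Signing n)
allSignings zero    = List.[ (λ ()) ]
allSignings (suc n) = List.map (Sign.+ Vec.∷_) (allSignings n) List.++ List.map (Sign.- Vec.∷_) (allSignings n)

allPlus : ∀ {n} → Signing n
allPlus _ = Sign.+

-- The default allPlus of argmin is itself a signed domination function (allPlus-dominates).
γₛ : ∀ {n} → Graph n → ℤ
γₛ {n} G = weight (argmin weight allPlus (List.filter (isSignedDomination? G) (allSignings n)))

allSignings-complete : ∀ n (f : Signing n) → Any (_≗ f) (allSignings n)
allSignings-complete zero    f = here λ ()
allSignings-complete (suc n) f = go (f Fin.zero) refl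
  where
  extend : ∀ s → f Fin.zero ≡ s → Any (_≗ f) (List.map (s Vec.∷_) (allSignings n))
  extend s eq = Any.map⁺ (Any.map
    (λ {g} g≗f → λ { Fin.zero → sym eq ; (Fin.suc i) → g≗f i })
    (allSignings-complete n (λ i → f (Fin.suc i))))
  go : ∀ s → f Fin.zero ≡ s → Any (_≗ f) (allSignings (suc n))
  go Sign.+ eq = Any.++⁺ˡ (extend Sign.+ eq)
  go Sign.- eq = Any.++⁺ʳ (List.map (Sign.+ Vec.∷_) (allSignings n)) (extend Sign.- eq)

sumOver-cong : ∀ {n} (xs : List (Fin n)) {f g : Signing n} → f ≗ g → sumOver xs f ≡ sumOver xs g
sumOver-cong List.[]       f≗g = refl
sumOver-cong (x List.∷ xs) f≗g = cong₂ (λ s t → (s ℤ.◃ 1) ℤ.+ t) (f≗g x) (sumOver-cong xs f≗g)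

sumOver-allPlus : ∀ {n} (xs : List (Fin n)) → sumOver xs allPlus ≡ + List.length xs
sumOver-allPlus List.[]       = refl
sumOver-allPlus (x List.∷ xs) = cong (λ s → 1ℤ ℤ.+ s) (sumOver-allPlus xs)

allPlus-dominates : ∀ {n} (G : Graph n) → IsSignedDomination G allPlus
allPlus-dominates G v = subst (1ℤ ℤ.≤_) (sym (sumOver-allPlus (N[_] G v)))
  (ℤ.+≤+ (∈-length (∈-filter⁺ (λ u → (u Fin.≟ v) ⊎-dec adj? G v u) (∈-allFin v) (inj₁ refl))))

γₛ-attained : ∀ {n} (G : Graph n) → ∃[ f ] IsSignedDomination G f × weight f ≡ γₛ G
γₛ-attained {n} G = argmin weight allPlus fs
                  , argmin-all weight (allPlus-dominates G) (All.all-filter (isSignedDomination? G) (allSignings n))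
                  , refl
  where fs = List.filter (isSignedDomination? G) (allSignings n)

γₛ-minimal : ∀ {n} (G : Graph n) (f : Signing n) → IsSignedDomination G f → γₛ G ℤ.≤ weight f
γₛ-minimal {n} G f f-dom with find (allSignings-complete n f)
... | g , g∈all , g≗f = f[argmin]≤v⁺ allPlus _ (inj₂ (lose g∈fs (ℤ.≤-reflexive (sumOver-cong (List.allFin n) g≗f))))
  where
  g-dom : IsSignedDomination G g
  g-dom v = subst (1ℤ ℤ.≤_) (sumOver-cong (N[_] G v) λ x → sym (g≗f x)) (f-dom v)
  g∈fs = ∈-filter⁺ (isSignedDomination? G) g∈all g-dom

module Submission where

-- Write d = δ + 1 and choose k, s with 2ᵏ ≤ d < 2ᵏ⁺¹ and s² ≤ 3kd < (s+1)².
-- Make every vertex positive independently with probability (1 + ε)/2, where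
-- ε = (s+1)/d, and then turn the whole of N[v] positive for every vertex v with
-- f(N[v]) ≤ 0, at a cost of at most 2m for m = |N[v]|.  Giving a positive vertex
-- the factor 1/(1+ε) and a negative one the factor 1+ε, the product over N[v] is
-- at least 1 when f(N[v]) ≤ 0, and its mean is (1 - ε²/2)ᵐ.  So some choice gives
-- γₛ ≤ n (ε + max 2m (1 - ε²/2)ᵐ), and the maximum is attained at m = d.  With
-- y = 3/(4d) we have 1 - ε²/2 ≤ 1 - 2ky ≤ (1 - y)²ᵏ and (1 - y)ᵈ ≤ 1/2, so it is at
-- most 2d/4ᵏ ≤ 8/d, and γₛ ≤ n (s + 9)/d.  The harmonic sum bounds ln d below by
-- k/2, whence s ≤ √(3kd) ≤ √(6 d ln d); the rest is absorbed by the constant 1.21.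

open import Defs
open import Algebra.Bundles using (CommutativeRing)
open import Data.Bool using (true; false; if_then_else_)
open import Data.Nat using (ℕ; zero; suc; _≤_; _^_)
import Data.Nat as ℕ
import Data.Nat.Properties as ℕ
open import Data.Integer using (+_; -[1+_]; 1ℤ)
import Data.Integer as ℤ
import Data.Integer.Properties as ℤ
open import Data.Rational using (ℚ; 0ℚ; 1ℚ; ½; toℚᵘ; _/_; _+_; _*_; _-_; -_)
import Data.Rational as ℚ
import Data.Rational.Properties as ℚ
open import Data.Rational.Literals using (fromℤ)
open import Data.Rational.Solver using (module +-*-Solver)
open import Data.Rational.Unnormalised using (mkℚᵘ; *≡*)
import Data.Rational.Unnormalised as ℚᵘ
import Data.Rational.Unnormalised.Properties as ℚᵘ
open import Data.Fin as Fin using (Fin)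
open import Data.List as List using (List; []; _∷_; length; filter; allFin)
import Data.List.Properties as List
open import Data.List.Membership.Propositional using (_∈_)
open import Data.List.Membership.Propositional.Properties using (∈-allFin)
open import Data.List.Relation.Unary.All as All using (All; []; _∷_)
import Data.List.Relation.Unary.All.Properties as All
open import Data.List.Relation.Unary.Any using (here; there)
open import Data.Sign as Sign using (Sign)
import Data.Vec.Functional as Vec
open import Data.Product using (∃-syntax; _×_; _,_; proj₁; proj₂)
open import Data.Sum using (_⊎_; inj₁; inj₂)
open import Function using (_∘_; id)
open import Relation.Nullary using (¬_; yes; no; does; contradiction)
open import Relation.Nullary.Decidable using (_⊎-dec_; from-yes)
import Relation.Unary as Unary
open import Relation.Binary.PropositionalEquality
  using (_≡_; _≗_; refl; sym; trans; cong; cong₂; subst; module ≡-Reasoning)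
open +-*-Solver using (solve; con; _:+_; _:*_; _:-_; :-_; _:=_)
open import Algebra.Properties.CommutativeSemiring.Exp
  (CommutativeRing.commutativeSemiring ℚ.+-*-commutativeRing)
  using (^-distrib-*; ^-assocʳ; ^-homo-*) renaming (_^_ to _^ℚ_)

-- Rational arithmetic, and sums and products over lists.

-- Serves polynomial inequalities: the slack `r` is given explicitly, so that only an identity is
-- left to the solver.
≤-by : ∀ {p q} r → 0ℚ ℚ.≤ r → p + r ≡ q → p ℚ.≤ q
≤-by {p} r 0≤r p+r≡q = ℚ.≤-trans (ℚ.≤-reflexive (sym (ℚ.+-identityʳ p)))
  (ℚ.≤-trans (ℚ.+-monoʳ-≤ p 0≤r) (ℚ.≤-reflexive p+r≡q))

0≤1 : 0ℚ ℚ.≤ 1ℚ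
0≤1 = fromℕ-nonNeg 1

0≤½ : 0ℚ ℚ.≤ ½
0≤½ = ℚ.<⇒≤ (ℚ.positive⁻¹ ½)

*-monoˡ : ∀ {p q} r → 0ℚ ℚ.≤ r → p ℚ.≤ q → r * p ℚ.≤ r * q
*-monoˡ r 0≤r = ℚ.*-monoˡ-≤-nonNeg r {{ℚ.nonNegative 0≤r}}

*-monoʳ : ∀ {p q} r → 0ℚ ℚ.≤ r → p ℚ.≤ q → p * r ℚ.≤ q * r
*-monoʳ r 0≤r = ℚ.*-monoʳ-≤-nonNeg r {{ℚ.nonNegative 0≤r}}

fromℤ-+ : ∀ i j → fromℤ (i ℤ.+ j) ≡ fromℤ i + fromℤ j
fromℤ-+ i j = ℚ.toℚᵘ-injective (begin
  mkℚᵘ (i ℤ.+ j) 0                 ≈⟨ *≡* (cong (ℤ._* + 1) (cong₂ ℤ._+_ (sym (ℤ.*-identityʳ i)) (sym (ℤ.*-identityʳ j)))) ⟩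
  mkℚᵘ i 0 ℚᵘ.+ mkℚᵘ j 0           ≈⟨ ℚᵘ.≃-sym (ℚ.toℚᵘ-homo-+ (fromℤ i) (fromℤ j)) ⟩
  toℚᵘ (fromℤ i + fromℤ j)         ∎)
  where open ℚᵘ.≃-Reasoning

fromℤ-mono-≤ : ∀ {i j} → i ℤ.≤ j → fromℤ i ℚ.≤ fromℤ j
fromℤ-mono-≤ i≤j = ℚ.*≤* (ℤ.*-monoʳ-≤-nonNeg (+ 1) i≤j)

fromℕ-+ : ∀ m n → fromℕ (m ℕ.+ n) ≡ fromℕ m + fromℕ n
fromℕ-+ m n = fromℤ-+ (+ m) (+ n)

fromℕ-* : ∀ m n → fromℕ (m ℕ.* n) ≡ fromℕ m * fromℕ n
fromℕ-* zero    n = sym (ℚ.*-zeroˡ (fromℕ n))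
fromℕ-* (suc m) n = begin
  fromℕ (n ℕ.+ m ℕ.* n)            ≡⟨ fromℕ-+ n (m ℕ.* n) ⟩
  fromℕ n + fromℕ (m ℕ.* n)        ≡⟨ cong (_+_ (fromℕ n)) (fromℕ-* m n) ⟩
  fromℕ n + fromℕ m * fromℕ n      ≡⟨ solve 2 (λ m n → n :+ m :* n := (con 1ℚ :+ m) :* n) refl (fromℕ m) (fromℕ n) ⟩
  (1ℚ + fromℕ m) * fromℕ n         ≡⟨ cong (_* fromℕ n) (fromℕ-suc m) ⟨
  fromℕ (suc m) * fromℕ n          ∎
  where open ≡-Reasoning

^ℚ-nonNeg : ∀ {p} n → 0ℚ ℚ.≤ p → 0ℚ ℚ.≤ p ^ℚ n
^ℚ-nonNeg zero    0≤p = 0≤1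
^ℚ-nonNeg (suc n) 0≤p = *-nonNeg 0≤p (^ℚ-nonNeg n 0≤p)

^ℚ-mono-≤ : ∀ {p q} n → 0ℚ ℚ.≤ p → p ℚ.≤ q → p ^ℚ n ℚ.≤ q ^ℚ n
^ℚ-mono-≤ zero    0≤p p≤q = ℚ.≤-refl
^ℚ-mono-≤ (suc n) 0≤p p≤q =
  *-mono-≤ 0≤p (^ℚ-nonNeg n (ℚ.≤-trans 0≤p p≤q)) p≤q (^ℚ-mono-≤ n 0≤p p≤q)

1^ℚ : ∀ n → 1ℚ ^ℚ n ≡ 1ℚ
1^ℚ zero    = refl
1^ℚ (suc n) = trans (ℚ.*-identityˡ (1ℚ ^ℚ n)) (1^ℚ n)

1≤^ℚ : ∀ {p} n → 1ℚ ℚ.≤ p → 1ℚ ℚ.≤ p ^ℚ n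
1≤^ℚ {p} n 1≤p = subst (ℚ._≤ p ^ℚ n) (1^ℚ n) (^ℚ-mono-≤ n 0≤1 1≤p)

sumOf : ∀ {A : Set} → (A → ℚ) → List A → ℚ
sumOf h = List.foldr (λ x s → h x + s) 0ℚ

productOf : ∀ {A : Set} → (A → ℚ) → List A → ℚ
productOf h = List.foldr (λ x s → h x * s) 1ℚ

sumOf-≤ : ∀ {A : Set} {h : A → ℚ} {B} → (∀ x → h x ℚ.≤ B) → ∀ xs → sumOf h xs ℚ.≤ fromℕ (length xs) * B
sumOf-≤ {B = B} h≤B []       = ℚ.≤-reflexive (sym (ℚ.*-zeroˡ B))
sumOf-≤ {h = h} {B} h≤B (x ∷ xs) = begin
  h x + sumOf h xs                ≤⟨ ℚ.+-mono-≤ (h≤B x) (sumOf-≤ h≤B xs) ⟩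
  B + fromℕ (length xs) * B       ≡⟨ solve 2 (λ b l → b :+ l :* b := (con 1ℚ :+ l) :* b) refl B (fromℕ (length xs)) ⟩
  (1ℚ + fromℕ (length xs)) * B    ≡⟨ cong (_* B) (fromℕ-suc (length xs)) ⟨
  fromℕ (suc (length xs)) * B     ∎
  where open ℚ.≤-Reasoning

productOf-nonNeg : ∀ {A : Set} {h : A → ℚ} → (∀ x → 0ℚ ℚ.≤ h x) → ∀ xs → 0ℚ ℚ.≤ productOf h xs
productOf-nonNeg 0≤h []       = 0≤1
productOf-nonNeg 0≤h (x ∷ xs) = *-nonNeg (0≤h x) (productOf-nonNeg 0≤h xs)

productOf-const : ∀ {A : Set} c (xs : List A) → productOf (λ _ → c) xs ≡ c ^ℚ length xs
productOf-const c []       = refl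
productOf-const c (x ∷ xs) = cong (c *_) (productOf-const c xs)

-- Raising a signing on a set of vertices.

infix 4 _⊑_

_⊑_ : ∀ {n} → Signing n → Signing n → Set
f ⊑ g = ∀ u → (f u ℤ.◃ 1) ℤ.≤ (g u ℤ.◃ 1)

sumOver-mono-⊑ : ∀ {n} (xs : List (Fin n)) {f g : Signing n} → f ⊑ g → sumOver xs f ℤ.≤ sumOver xs g
sumOver-mono-⊑ []       f⊑g = ℤ.≤-refl
sumOver-mono-⊑ (x ∷ xs) f⊑g = ℤ.+-mono-≤ (f⊑g x) (sumOver-mono-⊑ xs f⊑g)

sumOver-positive : ∀ {n} {xs : List (Fin n)} {f : Signing n} →
  All (λ u → f u ≡ Sign.+) xs → sumOver xs f ≡ + length xs
sumOver-positive []                = refl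
sumOver-positive (eq ∷ eqs) rewrite eq = cong (λ s → 1ℤ ℤ.+ s) (sumOver-positive eqs)

◃1≤1 : ∀ s → (s ℤ.◃ 1) ℤ.≤ 1ℤ
◃1≤1 Sign.+ = ℤ.≤-refl
◃1≤1 Sign.- = ℤ.-≤+

1≤◃1+2 : ∀ s → 1ℤ ℤ.≤ (s ℤ.◃ 1) ℤ.+ + 2
1≤◃1+2 Sign.+ = ℤ.+≤+ (ℕ.s≤s ℕ.z≤n)
1≤◃1+2 Sign.- = ℤ.≤-refl

module _ {n} {P : Fin n → Set} (P? : Unary.Decidable P) where

  raise : Signing n → Signing n
  raise f u = if does (P? u) then Sign.+ else f u

  raise-⊒ : ∀ f → f ⊑ raise f
  raise-⊒ f u with does (P? u)
  ... | true  = ◃1≤1 (f u)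
  ... | false = ℤ.≤-refl

  raise-positive : ∀ f {u} → P u → raise f u ≡ Sign.+
  raise-positive f {u} Pu with P? u
  ... | yes _  = refl
  ... | no ¬Pu = contradiction Pu ¬Pu

  -- A raised vertex gains at most 2, by going from -1 to 1. The filter also counts vertices that
  -- were positive already.
  sumOver-raise-≤ : ∀ xs f → sumOver xs (raise f) ℤ.≤ sumOver xs f ℤ.+ + (2 ℕ.* length (filter P? xs))
  sumOver-raise-≤ []       f = ℤ.≤-refl
  sumOver-raise-≤ (x ∷ xs) f with does (P? x) | sumOver-raise-≤ xs f
  ... | true  | ih = begin
    1ℤ ℤ.+ sumOver xs (raise f)
      ≤⟨ ℤ.+-mono-≤ (1≤◃1+2 (f x)) ih ⟩
    (f x ℤ.◃ 1) ℤ.+ + 2 ℤ.+ (sumOver xs f ℤ.+ + (2 ℕ.* l))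
      ≡⟨ interchange (f x ℤ.◃ 1) (+ 2) (sumOver xs f) (+ (2 ℕ.* l)) ⟩
    (f x ℤ.◃ 1) ℤ.+ sumOver xs f ℤ.+ + (2 ℕ.+ 2 ℕ.* l)
      ≡⟨ cong (λ k → (f x ℤ.◃ 1) ℤ.+ sumOver xs f ℤ.+ + k) (sym (ℕ.*-suc 2 l)) ⟩
    (f x ℤ.◃ 1) ℤ.+ sumOver xs f ℤ.+ + (2 ℕ.* suc l) ∎
    where
    open ℤ.≤-Reasoning
    open import Algebra.Properties.CommutativeSemigroup ℤ.+-commutativeSemigroup using (interchange)
    l = length (filter P? xs)
  ... | false | ih = begin
    (f x ℤ.◃ 1) ℤ.+ sumOver xs (raise f)
      ≤⟨ ℤ.+-monoʳ-≤ (f x ℤ.◃ 1) ih ⟩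
    (f x ℤ.◃ 1) ℤ.+ (sumOver xs f ℤ.+ + (2 ℕ.* l))
      ≡⟨ ℤ.+-assoc (f x ℤ.◃ 1) (sumOver xs f) (+ (2 ℕ.* l)) ⟨
    (f x ℤ.◃ 1) ℤ.+ sumOver xs f ℤ.+ + (2 ℕ.* l) ∎
    where
    open ℤ.≤-Reasoning
    l = length (filter P? xs)

-- Repair of closed neighbourhoods.

module _ {n} (G : Graph n) where

  N? : ∀ v → Unary.Decidable (λ u → (u ≡ v) ⊎ Adj G v u)
  N? v u = (u Fin.≟ v) ⊎-dec adj? G v u

  -- Every neighbour passes both filters. The entry `v` itself passes only that of `N[ v ]`, by
  -- irreflexivity, and makes the inequality strict.
  degree<∣N∣ : ∀ v → degree G v ℕ.< length (N[_] G v)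
  degree<∣N∣ v = strict (∈-allFin v)
    where
    weak : ∀ xs → length (filter (adj? G v) xs) ≤ length (filter (N? v) xs)
    weak []       = ℕ.z≤n
    weak (x ∷ xs) with x Fin.≟ v | adj? G v x
    ... | yes _ | yes _ = ℕ.s≤s (weak xs)
    ... | yes _ | no  _ = ℕ.m≤n⇒m≤1+n (weak xs)
    ... | no  _ | yes _ = ℕ.s≤s (weak xs)
    ... | no  _ | no  _ = weak xs
    strict : ∀ {xs} → v ∈ xs → length (filter (adj? G v) xs) ℕ.< length (filter (N? v) xs)
    strict {x ∷ xs} (here v≡x) with x Fin.≟ v | adj? G v x
    ... | yes _   | yes vx = contradiction vx (adj-irrefl G v≡x)
    ... | yes _   | no  _  = ℕ.s≤s (weak xs)
    ... | no  x≢v | _      = contradiction (sym v≡x) x≢v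
    strict {x ∷ xs} (there v∈xs) with x Fin.≟ v | adj? G v x
    ... | yes _ | yes _ = ℕ.s≤s (strict v∈xs)
    ... | yes _ | no  _ = ℕ.m≤n⇒m≤1+n (strict v∈xs)
    ... | no  _ | yes _ = ℕ.s≤s (strict v∈xs)
    ... | no  _ | no  _ = strict v∈xs

  -- `cost` majorises the indicator of a bad vertex times the price of its repair. This leaves room
  -- for a product over `N[ v ]`, whose mean can be computed exactly.
  module Repair (f : Signing n) (cost : Fin n → ℚ) (0≤cost : ∀ v → 0ℚ ℚ.≤ cost v)
    (bad-cost : ∀ v → ¬ 1ℤ ℤ.≤ sumOver (N[_] G v) f → fromℕ (2 ℕ.* length (N[_] G v)) ℚ.≤ cost v) where

    -- A vertex is tested against the original `f`, not against the current `g`, so that the total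
    -- charge depends on `f` alone. Repairs only raise signs, so a neighbourhood that was good or
    -- has been repaired stays good.
    repair : ∀ vs → ∃[ g ] f ⊑ g × All (λ v → 1ℤ ℤ.≤ sumOver (N[_] G v) g) vs
      × fromℤ (weight g) ℚ.≤ fromℤ (weight f) + sumOf cost vs
    repair [] = f , (λ _ → ℤ.≤-refl) , [] , ℚ.≤-reflexive (sym (ℚ.+-identityʳ _))
    repair (v ∷ vs) with repair vs | 1ℤ ℤ.≤? sumOver (N[_] G v) f
    ... | g , f⊑g , dom , wg≤ | yes good =
      g , f⊑g , ℤ.≤-trans good (sumOver-mono-⊑ (N[_] G v) f⊑g) ∷ dom ,
      ℚ.≤-trans wg≤ (ℚ.+-monoʳ-≤ (fromℤ (weight f)) (≤-by {sumOf cost vs} (cost v) (0≤cost v) (ℚ.+-comm (sumOf cost vs) (cost v))))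
    ... | g , f⊑g , dom , wg≤ | no bad =
      g′ , (λ u → ℤ.≤-trans (f⊑g u) (g⊑g′ u)) ,
      1≤Ng′ ∷ All.map (λ {u} 1≤ → ℤ.≤-trans 1≤ (sumOver-mono-⊑ (N[_] G u) g⊑g′)) dom ,
      (begin
        fromℤ (weight g′)                                      ≤⟨ fromℤ-mono-≤ (sumOver-raise-≤ (N? v) (allFin n) g) ⟩
        fromℤ (weight g ℤ.+ + (2 ℕ.* length (N[_] G v)))       ≡⟨ fromℤ-+ (weight g) (+ (2 ℕ.* length (N[_] G v))) ⟩
        fromℤ (weight g) + fromℕ (2 ℕ.* length (N[_] G v))     ≤⟨ ℚ.+-mono-≤ wg≤ (bad-cost v bad) ⟩
        fromℤ (weight f) + sumOf cost vs + cost v              ≡⟨ solve 3 (λ w s c → w :+ s :+ c := w :+ (c :+ s)) refl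
                                                                    (fromℤ (weight f)) (sumOf cost vs) (cost v) ⟩
        fromℤ (weight f) + sumOf cost (v ∷ vs)                 ∎)
      where
      open ℚ.≤-Reasoning
      g′ = raise (N? v) g
      g⊑g′ = raise-⊒ (N? v) g
      1≤Ng′ : 1ℤ ℤ.≤ sumOver (N[_] G v) g′
      1≤Ng′ = subst (1ℤ ℤ.≤_)
        (sym (sumOver-positive (All.map (raise-positive (N? v) g) (All.all-filter (N? v) (allFin n)))))
        (ℤ.+≤+ (ℕ.≤-trans (ℕ.s≤s ℕ.z≤n) (degree<∣N∣ v)))

    γₛ-≤ : fromℤ (γₛ G) ℚ.≤ fromℤ (weight f) + sumOf cost (allFin n)
    γₛ-≤ with repair (allFin n)
    ... | g , _ , dom , wg≤ = ℚ.≤-trans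
      (fromℤ-mono-≤ (γₛ-minimal G g (λ v → All.lookup dom (∈-allFin v)))) wg≤

-- Expectation over independent random signs.

module Random (p q : ℚ) (0≤p : 0ℚ ℚ.≤ p) (0≤q : 0ℚ ℚ.≤ q) (p+q≡1 : p + q ≡ 1ℚ) where

  -- Conditioning on the first vertex, with `p` and `q` the probabilities of the two signs, turns
  -- each fact about means into an induction on `n`.
  𝔼 : ∀ n → (Signing n → ℚ) → ℚ
  𝔼 zero    F = F Vec.[]
  𝔼 (suc n) F = p * 𝔼 n (λ f → F (Sign.+ Vec.∷ f)) + q * 𝔼 n (λ f → F (Sign.- Vec.∷ f))

  mean : ∀ c → p * c + q * c ≡ c
  mean c = trans (sym (ℚ.*-distribʳ-+ c p q)) (trans (cong (_* c) p+q≡1) (ℚ.*-identityˡ c))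

  𝔼-cong : ∀ n {F G : Signing n → ℚ} → F ≗ G → 𝔼 n F ≡ 𝔼 n G
  𝔼-cong zero    F≗G = F≗G Vec.[]
  𝔼-cong (suc n) F≗G = cong₂ (λ x y → p * x + q * y)
    (𝔼-cong n λ f → F≗G (Sign.+ Vec.∷ f)) (𝔼-cong n λ f → F≗G (Sign.- Vec.∷ f))

  𝔼-const : ∀ n c → 𝔼 n (λ _ → c) ≡ c
  𝔼-const zero    c = refl
  𝔼-const (suc n) c = trans (cong₂ (λ x y → p * x + q * y) (𝔼-const n c) (𝔼-const n c)) (mean c)

  𝔼-+ : ∀ n F G → 𝔼 n (λ f → F f + G f) ≡ 𝔼 n F + 𝔼 n G
  𝔼-+ zero    F G = refl
  𝔼-+ (suc n) F G = trans
    (cong₂ (λ x y → p * x + q * y) (𝔼-+ n (λ f → F (Sign.+ Vec.∷ f)) (λ f → G (Sign.+ Vec.∷ f)))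
                                   (𝔼-+ n (λ f → F (Sign.- Vec.∷ f)) (λ f → G (Sign.- Vec.∷ f))))
    (solve 6 (λ p q a b c d → p :* (a :+ b) :+ q :* (c :+ d) := p :* a :+ q :* c :+ (p :* b :+ q :* d)) refl
      p q _ _ _ _)

  𝔼-* : ∀ n c F → 𝔼 n (λ f → c * F f) ≡ c * 𝔼 n F
  𝔼-* zero    c F = refl
  𝔼-* (suc n) c F = trans
    (cong₂ (λ x y → p * x + q * y) (𝔼-* n c (λ f → F (Sign.+ Vec.∷ f))) (𝔼-* n c (λ f → F (Sign.- Vec.∷ f))))
    (solve 5 (λ p q c a b → p :* (c :* a) :+ q :* (c :* b) := c :* (p :* a :+ q :* b)) refl p q c _ _)

  𝔼-sumOf : ∀ n {A : Set} (F : A → Signing n → ℚ) xs →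
    𝔼 n (λ f → sumOf (λ x → F x f) xs) ≡ sumOf (λ x → 𝔼 n (F x)) xs
  𝔼-sumOf n F []       = 𝔼-const n 0ℚ
  𝔼-sumOf n F (x ∷ xs) = trans (𝔼-+ n (F x) (λ f → sumOf (λ x → F x f) xs)) (cong (_+_ (𝔼 n (F x))) (𝔼-sumOf n F xs))

  -- Conditional expectations: fix the vertices one by one, each time taking the sign whose
  -- conditional mean is smaller, since the smaller of two numbers is at most their weighted
  -- average.
  𝔼-attained : ∀ n F → ∃[ f ] F f ℚ.≤ 𝔼 n F
  𝔼-attained zero    F = Vec.[] , ℚ.≤-refl
  𝔼-attained (suc n) F = choose (𝔼-attained n (λ f → F (Sign.+ Vec.∷ f))) (𝔼-attained n (λ f → F (Sign.- Vec.∷ f)))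
    where
    E₊ = 𝔼 n (λ f → F (Sign.+ Vec.∷ f))
    E₋ = 𝔼 n (λ f → F (Sign.- Vec.∷ f))
    choose : ∃[ f ] F (Sign.+ Vec.∷ f) ℚ.≤ E₊ → ∃[ f ] F (Sign.- Vec.∷ f) ℚ.≤ E₋ → ∃[ f ] F f ℚ.≤ p * E₊ + q * E₋
    choose (f , f≤) (g , g≤) with ℚ.≤-total E₊ E₋
    ... | inj₁ ₊≤₋ = Sign.+ Vec.∷ f , ℚ.≤-trans f≤
      (subst (ℚ._≤ p * E₊ + q * E₋) (mean E₊) (ℚ.+-monoʳ-≤ (p * E₊) (*-monoˡ q 0≤q ₊≤₋)))
    ... | inj₂ ₋≤₊ = Sign.- Vec.∷ g , ℚ.≤-trans g≤
      (subst (ℚ._≤ p * E₊ + q * E₋) (mean E₋) (ℚ.+-monoˡ-≤ (q * E₋) (*-monoˡ p 0≤p ₋≤₊)))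

  -- By linearity, since each single sign has mean `p - q`.
  𝔼-weight : ∀ n → 𝔼 n (λ f → fromℤ (weight f)) ≡ fromℕ n * (p - q)
  𝔼-weight zero    = sym (ℚ.*-zeroˡ (p - q))
  𝔼-weight (suc n) = begin
    p * 𝔼 n (λ f → fromℤ (weight (Sign.+ Vec.∷ f))) + q * 𝔼 n (λ f → fromℤ (weight (Sign.- Vec.∷ f)))
      ≡⟨ cong₂ (λ x y → p * x + q * y) (first Sign.+) (first Sign.-) ⟩
    p * (1ℚ + 𝔼 n (λ f → fromℤ (weight f))) + q * (- 1ℚ + 𝔼 n (λ f → fromℤ (weight f)))
      ≡⟨ solve 3 (λ p q e → p :* (con 1ℚ :+ e) :+ q :* (:- con 1ℚ :+ e) := p :* e :+ q :* e :+ (p :- q)) refl p q _ ⟩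
    p * 𝔼 n (λ f → fromℤ (weight f)) + q * 𝔼 n (λ f → fromℤ (weight f)) + (p - q)
      ≡⟨ cong (_+ (p - q)) (trans (mean _) (𝔼-weight n)) ⟩
    fromℕ n * (p - q) + (p - q)
      ≡⟨ solve 2 (λ n r → n :* r :+ r := (con 1ℚ :+ n) :* r) refl (fromℕ n) (p - q) ⟩
    (1ℚ + fromℕ n) * (p - q)
      ≡⟨ cong (_* (p - q)) (fromℕ-suc n) ⟨
    fromℕ (suc n) * (p - q) ∎
    where
    open ≡-Reasoning
    -- General in `h` because the recursion precomposes it with `Fin.suc`.
    shift : ∀ {k m} s (f : Signing m) (h : Fin k → Fin m) →
      sumOver (List.tabulate (Fin.suc ∘ h)) (s Vec.∷ f) ≡ sumOver (List.tabulate h) f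
    shift {zero}  s f h = refl
    shift {suc k} s f h = cong (λ z → (f (h Fin.zero) ℤ.◃ 1) ℤ.+ z) (shift s f (h ∘ Fin.suc))
    first : ∀ s → 𝔼 n (λ f → fromℤ (weight (s Vec.∷ f))) ≡ fromℤ (s ℤ.◃ 1) + 𝔼 n (λ f → fromℤ (weight f))
    first s = begin
      𝔼 n (λ f → fromℤ (weight (s Vec.∷ f)))
        ≡⟨ 𝔼-cong n (λ f → trans (fromℤ-+ (s ℤ.◃ 1) (sumOver (List.tabulate Fin.suc) (s Vec.∷ f)))
             (cong (λ z → fromℤ (s ℤ.◃ 1) + fromℤ z) (shift s f id))) ⟩
      𝔼 n (λ f → fromℤ (s ℤ.◃ 1) + fromℤ (weight f))
        ≡⟨ 𝔼-+ n (λ _ → fromℤ (s ℤ.◃ 1)) (λ f → fromℤ (weight f)) ⟩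
      𝔼 n (λ _ → fromℤ (s ℤ.◃ 1)) + 𝔼 n (λ f → fromℤ (weight f))
        ≡⟨ cong (_+ 𝔼 n (λ f → fromℤ (weight f))) (𝔼-const n _) ⟩
      fromℤ (s ℤ.◃ 1) + 𝔼 n (λ f → fromℤ (weight f)) ∎

  ∏ : ∀ n → (Fin n → ℚ) → ℚ
  ∏ n = Vec.foldr _*_ 1ℚ

  ∏-cong : ∀ n {g h : Fin n → ℚ} → g ≗ h → ∏ n g ≡ ∏ n h
  ∏-cong zero    g≗h = refl
  ∏-cong (suc n) g≗h = cong₂ _*_ (g≗h Fin.zero) (∏-cong n (g≗h ∘ Fin.suc))

  -- This is independence: the factor at a vertex depends on the sign there only, so conditioning on
  -- the first vertex pulls its factor out of the remaining mean.
  𝔼-∏ : ∀ n (w : Fin n → Sign → ℚ) →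
    𝔼 n (λ f → ∏ n (λ i → w i (f i))) ≡ ∏ n (λ i → p * w i Sign.+ + q * w i Sign.-)
  𝔼-∏ zero    w = refl
  𝔼-∏ (suc n) w = trans
    (cong₂ (λ x y → p * x + q * y) (𝔼-* n (w Fin.zero Sign.+) rest) (𝔼-* n (w Fin.zero Sign.-) rest))
    (trans (solve 5 (λ p q a b r → p :* (a :* r) :+ q :* (b :* r) := (p :* a :+ q :* b) :* r) refl p q _ _ _)
      (cong (_*_ (p * w Fin.zero Sign.+ + q * w Fin.zero Sign.-)) (𝔼-∏ n (w ∘ Fin.suc))))
    where
    rest : Signing n → ℚ
    rest f = ∏ n (λ i → w (Fin.suc i) (f i))

  module _ {m} {P : Fin m → Set} (P? : Unary.Decidable P) where

    -- Padding with factors 1 turns a product over part of the vertices into one over all of them,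
    -- the shape that `𝔼-∏` handles.
    productOf-filter : ∀ n (w : Fin m → ℚ) (h : Fin n → Fin m) →
      productOf w (filter P? (List.tabulate h)) ≡ ∏ n (λ i → if does (P? (h i)) then w (h i) else 1ℚ)
    productOf-filter zero    w h = refl
    productOf-filter (suc n) w h with does (P? (h Fin.zero))
    ... | true  = cong (w (h Fin.zero) *_) (productOf-filter n w (h ∘ Fin.suc))
    ... | false = trans (productOf-filter n w (h ∘ Fin.suc)) (sym (ℚ.*-identityˡ _))

    𝔼-productOf : ∀ (w : Sign → ℚ) → 𝔼 m (λ f → productOf (w ∘ f) (filter P? (allFin m)))
      ≡ (p * w Sign.+ + q * w Sign.-) ^ℚ length (filter P? (allFin m))
    𝔼-productOf w = begin
      𝔼 m (λ f → productOf (w ∘ f) (filter P? (allFin m)))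
        ≡⟨ 𝔼-cong m (λ f → productOf-filter m (w ∘ f) id) ⟩
      𝔼 m (λ f → ∏ m (λ i → if does (P? i) then w (f i) else 1ℚ))
        ≡⟨ 𝔼-∏ m (λ i s → if does (P? i) then w s else 1ℚ) ⟩
      ∏ m (λ i → p * (if does (P? i) then w Sign.+ else 1ℚ) + q * (if does (P? i) then w Sign.- else 1ℚ))
        ≡⟨ ∏-cong m factor ⟩
      ∏ m (λ i → if does (P? i) then w̄ else 1ℚ)
        ≡⟨ productOf-filter m (λ _ → w̄) id ⟨
      productOf (λ _ → w̄) (filter P? (allFin m))
        ≡⟨ productOf-const w̄ (filter P? (allFin m)) ⟩
      w̄ ^ℚ length (filter P? (allFin m)) ∎
      where
      open ≡-Reasoning
      w̄ = p * w Sign.+ + q * w Sign.-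
      factor : ∀ i → p * (if does (P? i) then w Sign.+ else 1ℚ) + q * (if does (P? i) then w Sign.- else 1ℚ)
        ≡ (if does (P? i) then w̄ else 1ℚ)
      factor i with does (P? i)
      ... | true  = refl
      ... | false = mean 1ℚ

-- Exponential weights that detect bad neighbourhoods.

module SignWeight (b : ℚ) (1≤b : 1ℚ ℚ.≤ b) where

  0<b : 0ℚ ℚ.< b
  0<b = ℚ.<-≤-trans (ℚ.positive⁻¹ 1ℚ) 1≤b

  a : ℚ
  a = recip b 0<b

  signWeight : Sign → ℚ
  signWeight Sign.+ = a
  signWeight Sign.- = b

  0≤signWeight : ∀ s → 0ℚ ℚ.≤ signWeight s
  0≤signWeight Sign.+ = ℚ.<⇒≤ (recip-pos b 0<b)
  0≤signWeight Sign.- = ℚ.<⇒≤ 0<b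

  -- The witnesses `j` and `k` count the positive and the negative entries. As `a` is the reciprocal
  -- of `b`, the product is `b` to the power of minus the sum.
  counts : ∀ {n} (f : Signing n) xs →
    ∃[ j ] ∃[ k ] sumOver xs f ≡ j ℤ.⊖ k × productOf (signWeight ∘ f) xs ≡ a ^ℚ j * b ^ℚ k
  counts f []       = 0 , 0 , refl , refl
  counts f (x ∷ xs) with f x | counts f xs
  ... | Sign.+ | j , k , s≡ , ∏≡ = suc j , k ,
    trans (cong (λ z → 1ℤ ℤ.+ z) s≡) (ℤ.distribʳ-⊖-+-pos 1 j k) ,
    trans (cong (a *_) ∏≡) (sym (ℚ.*-assoc a (a ^ℚ j) (b ^ℚ k)))
  ... | Sign.- | j , k , s≡ , ∏≡ = j , suc k ,
    trans (cong (λ z → -[1+ 0 ] ℤ.+ z) s≡) (ℤ.distribʳ-⊖-+-neg 0 j k) ,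
    trans (cong (b *_) ∏≡) (solve 3 (λ a b c → b :* (a :* c) := a :* (b :* c)) refl (a ^ℚ j) b (b ^ℚ k))

  -- Each `a` cancels against one `b`, and a power of `b` remains.
  1≤a^j*b^k : ∀ {j k} → j ≤ k → 1ℚ ℚ.≤ a ^ℚ j * b ^ℚ k
  1≤a^j*b^k {_} {k} ℕ.z≤n = subst (1ℚ ℚ.≤_) (sym (ℚ.*-identityˡ (b ^ℚ k))) (1≤^ℚ k 1≤b)
  1≤a^j*b^k {suc j} {suc k} (ℕ.s≤s j≤k) = subst (1ℚ ℚ.≤_)
    (begin
      a ^ℚ j * b ^ℚ k                  ≡⟨ ℚ.*-identityˡ _ ⟨
      1ℚ * (a ^ℚ j * b ^ℚ k)           ≡⟨ cong (_* (a ^ℚ j * b ^ℚ k)) (*-recip b 0<b) ⟨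
      b * a * (a ^ℚ j * b ^ℚ k)        ≡⟨ solve 4 (λ a b c d → b :* a :* (c :* d) := a :* c :* (b :* d)) refl a b (a ^ℚ j) (b ^ℚ k) ⟩
      a * a ^ℚ j * (b * b ^ℚ k)        ∎)
    (1≤a^j*b^k j≤k)
    where open ≡-Reasoning

  -- The Markov step: the product dominates the indicator of a bad neighbourhood. More positive than
  -- negative entries would make the sum at least 1.
  1≤productOf : ∀ {n} (f : Signing n) xs → ¬ 1ℤ ℤ.≤ sumOver xs f → 1ℚ ℚ.≤ productOf (signWeight ∘ f) xs
  1≤productOf f xs ≱1 with counts f xs
  ... | j , k , s≡ , ∏≡ = subst (1ℚ ℚ.≤_) (sym ∏≡) (1≤a^j*b^k {j} {k} (ℕ.≮⇒≥ λ k<j → ≱1 (subst (1ℤ ℤ.≤_)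
    (sym (trans s≡ (ℤ.⊖-≥ (ℕ.<⇒≤ k<j)))) (ℤ.+≤+ (ℕ.m<n⇒0<n∸m k<j)))))

-- The first-moment bound with free parameters.

-- `ε` will be the mean of a single sign and `B` bounds the mean repair cost of a single vertex.
-- Keeping both open separates the probabilistic argument from the choice of parameters.
γₛ-bound : ∀ {n} (G : Graph n) ε B → 0ℚ ℚ.≤ ε → ε ℚ.≤ 1ℚ →
  (∀ v → fromℕ (2 ℕ.* length (N[_] G v)) * (1ℚ - ½ * (ε * ε)) ^ℚ length (N[_] G v) ℚ.≤ B) →
  fromℤ (γₛ G) ℚ.≤ fromℕ n * (ε + B)
γₛ-bound {n} G ε B 0≤ε ε≤1 ≤B = begin
  fromℤ (γₛ G)
    ≤⟨ Repair.γₛ-≤ G f (cost f) (0≤cost f) (bad-cost f) ⟩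
  Φ f
    ≤⟨ proj₂ (𝔼-attained n Φ) ⟩
  𝔼 n Φ
    ≡⟨ 𝔼-+ n (λ f → fromℤ (weight f)) (λ f → sumOf (cost f) (allFin n)) ⟩
  𝔼 n (λ f → fromℤ (weight f)) + 𝔼 n (λ f → sumOf (cost f) (allFin n))
    ≡⟨ cong₂ _+_ (𝔼-weight n) (𝔼-sumOf n (λ v f → cost f v) (allFin n)) ⟩
  fromℕ n * (p - q) + sumOf (λ v → 𝔼 n (λ f → cost f v)) (allFin n)
    ≤⟨ ℚ.+-monoʳ-≤ (fromℕ n * (p - q)) (sumOf-≤ 𝔼cost≤B (allFin n)) ⟩
  fromℕ n * (p - q) + fromℕ (length (allFin n)) * B
    ≡⟨ cong₂ (λ x y → fromℕ n * x + fromℕ y * B)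
         (solve 1 (λ e → con ½ :* (con 1ℚ :+ e) :- con ½ :* (con 1ℚ :- e) := e) refl ε)
         (List.length-tabulate {n = n} id) ⟩
  fromℕ n * ε + fromℕ n * B
    ≡⟨ ℚ.*-distribˡ-+ (fromℕ n) ε B ⟨
  fromℕ n * (ε + B) ∎
  where
  open ℚ.≤-Reasoning
  p = ½ * (1ℚ + ε)
  q = ½ * (1ℚ - ε)
  1≤1+ε : 1ℚ ℚ.≤ 1ℚ + ε
  1≤1+ε = ≤-by ε 0≤ε refl
  0≤p : 0ℚ ℚ.≤ p
  0≤p = *-nonNeg 0≤½ (ℚ.≤-trans 0≤1 1≤1+ε)
  0≤q : 0ℚ ℚ.≤ q
  0≤q = *-nonNeg 0≤½ (subst (ℚ._≤ 1ℚ - ε) (ℚ.+-inverseʳ ε) (ℚ.+-monoˡ-≤ (- ε) ε≤1))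
  open Random p q 0≤p 0≤q
    (solve 1 (λ e → con ½ :* (con 1ℚ :+ e) :+ con ½ :* (con 1ℚ :- e) := con 1ℚ) refl ε)
  open SignWeight (1ℚ + ε) 1≤1+ε
  2m : Fin n → ℚ
  2m v = fromℕ (2 ℕ.* length (N[_] G v))
  cost : Signing n → Fin n → ℚ
  cost f v = 2m v * productOf (signWeight ∘ f) (N[_] G v)
  0≤cost : ∀ f v → 0ℚ ℚ.≤ cost f v
  0≤cost f v = *-nonNeg (fromℕ-nonNeg (2 ℕ.* length (N[_] G v))) (productOf-nonNeg (λ u → 0≤signWeight (f u)) (N[_] G v))
  bad-cost : ∀ f v → ¬ 1ℤ ℤ.≤ sumOver (N[_] G v) f → 2m v ℚ.≤ cost f v
  bad-cost f v bad = subst (ℚ._≤ cost f v) (ℚ.*-identityʳ (2m v))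
    (*-monoˡ (2m v) (fromℕ-nonNeg (2 ℕ.* length (N[_] G v))) (1≤productOf f (N[_] G v) bad))
  Φ : Signing n → ℚ
  Φ f = fromℤ (weight f) + sumOf (cost f) (allFin n)
  f = proj₁ (𝔼-attained n Φ)
  -- With `a` = 1/(1+ε) the first term is 1/2, and the second is (1 - ε²)/2.
  mean-signWeight : p * a + q * (1ℚ + ε) ≡ 1ℚ - ½ * (ε * ε)
  mean-signWeight = begin-equality
    p * a + q * (1ℚ + ε)
      ≡⟨ solve 2 (λ e a → con ½ :* (con 1ℚ :+ e) :* a :+ con ½ :* (con 1ℚ :- e) :* (con 1ℚ :+ e)
           := con ½ :* ((con 1ℚ :+ e) :* a) :+ con ½ :* (con 1ℚ :- e :* e)) refl ε a ⟩
    ½ * ((1ℚ + ε) * a) + ½ * (1ℚ - ε * ε)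
      ≡⟨ cong (λ z → ½ * z + ½ * (1ℚ - ε * ε)) (*-recip (1ℚ + ε) 0<b) ⟩
    ½ * 1ℚ + ½ * (1ℚ - ε * ε)
      ≡⟨ solve 1 (λ e → con ½ :* con 1ℚ :+ con ½ :* (con 1ℚ :- e :* e) := con 1ℚ :- con ½ :* (e :* e)) refl ε ⟩
    1ℚ - ½ * (ε * ε) ∎
  𝔼cost≤B : ∀ v → 𝔼 n (λ f → cost f v) ℚ.≤ B
  𝔼cost≤B v = subst (ℚ._≤ B) (sym (begin-equality
    𝔼 n (λ f → cost f v)
      ≡⟨ 𝔼-* n (2m v) (λ f → productOf (signWeight ∘ f) (N[_] G v)) ⟩
    2m v * 𝔼 n (λ f → productOf (signWeight ∘ f) (N[_] G v))
      ≡⟨ cong (2m v *_) (𝔼-productOf (N? G v) signWeight) ⟩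
    2m v * (p * a + q * (1ℚ + ε)) ^ℚ length (N[_] G v)
      ≡⟨ cong (λ z → 2m v * z ^ℚ length (N[_] G v)) mean-signWeight ⟩
    2m v * (1ℚ - ½ * (ε * ε)) ^ℚ length (N[_] G v) ∎)) (≤B v)

-- Integer brackets and a lower bound for the logarithm.

-- Yields integer logarithms and square roots alike. When `m` grows by 1, the index has to advance
-- by at most one, because `g` is strictly increasing.
bracket : ∀ (g : ℕ → ℕ) → (∀ k → g k ℕ.< g (suc k)) → ∀ m → g 0 ≤ m → ∃[ k ] g k ≤ m × m ℕ.< g (suc k)
bracket g g-mono zero    g0≤0 = 0 , g0≤0 , ℕ.≤-<-trans ℕ.z≤n (g-mono 0)
bracket g g-mono (suc m) g0≤1+m with g 0 ℕ.≤? m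
... | no g0≰m = 0 , g0≤1+m , ℕ.≤-<-trans (ℕ.≰⇒> g0≰m) (g-mono 0)
... | yes g0≤m with bracket g g-mono m g0≤m
...   | k , lo , hi with g (suc k) ℕ.≤? suc m
...     | yes le = suc k , le , ℕ.≤-<-trans hi (g-mono (suc k))
...     | no  gt = k , ℕ.m≤n⇒m≤1+n lo , ℕ.≰⇒> gt

sum-nonNeg : ∀ k {f} → (∀ i → 0ℚ ℚ.≤ f i) → 0ℚ ℚ.≤ sum k f
sum-nonNeg zero    0≤f = ℚ.≤-refl
sum-nonNeg (suc k) 0≤f = ℚ.+-mono-≤ (sum-nonNeg k 0≤f) (0≤f k)

-- Oresme's argument. The sum is 1/2 + ... + 1/(t+1), and the 2ᵏ terms from 1/(2ᵏ+1) to 1/2ᵏ⁺¹ are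
-- each at least 1/2ᵏ⁺¹, so each doubling contributes at least 1/2.
harmonic-lower : ∀ k t → 2 ^ k ≤ suc t → fromℕ k * ½ ℚ.≤ sum t (λ i → inv (suc i))
harmonic-lower zero    t _ =
  subst (ℚ._≤ sum t (λ i → inv (suc i))) (sym (ℚ.*-zeroˡ ½)) (sum-nonNeg t λ i → ℚ.<⇒≤ (inv-pos (suc i)))
harmonic-lower (suc k) t 2^1+k≤ = begin
  fromℕ (suc k) * ½
    ≡⟨ cong (_* ½) (fromℕ-suc k) ⟩
  (1ℚ + fromℕ k) * ½
    ≡⟨ solve 1 (λ k → (con 1ℚ :+ k) :* con ½ := k :* con ½ :+ con ½ :+ con 0ℚ) refl (fromℕ k) ⟩
  fromℕ k * ½ + ½ + 0ℚ
    ≤⟨ ℚ.+-mono-≤ (ℚ.+-mono-≤ (harmonic-lower k u (ℕ.≤-reflexive (sym 1+u≡2^k))) block) tail≥0 ⟩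
  sum u (λ i → inv (suc i)) + sum (suc u) (λ i → inv (suc (u ℕ.+ i))) + sum (t ℕ.∸ v) (λ i → inv (suc (v ℕ.+ i)))
    ≡⟨ cong (_+ sum (t ℕ.∸ v) (λ i → inv (suc (v ℕ.+ i)))) (sum-+ u (suc u) (λ i → inv (suc i))) ⟨
  sum v (λ i → inv (suc i)) + sum (t ℕ.∸ v) (λ i → inv (suc (v ℕ.+ i)))
    ≡⟨ sum-+ v (t ℕ.∸ v) (λ i → inv (suc i)) ⟨
  sum (v ℕ.+ (t ℕ.∸ v)) (λ i → inv (suc i))
    ≡⟨ cong (λ l → sum l (λ i → inv (suc i))) (ℕ.m+[n∸m]≡n v≤t) ⟩
  sum t (λ i → inv (suc i)) ∎
  where
  open ℚ.≤-Reasoning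
  -- The sum begins at 1/2, so its first `u` terms end at 1/2ᵏ and its first `v` terms at 1/2ᵏ⁺¹.
  u = ℕ.pred (2 ^ k)
  v = u ℕ.+ suc u
  1+u≡2^k : suc u ≡ 2 ^ k
  1+u≡2^k = ℕ.suc-pred (2 ^ k) {{ℕ.m^n≢0 2 k}}
  v≤t : v ≤ t
  v≤t = ℕ.≤-pred (subst (_≤ suc t)
    (trans (cong (λ l → l ℕ.+ (l ℕ.+ 0)) (sym 1+u≡2^k)) (cong (λ l → suc u ℕ.+ l) (ℕ.+-identityʳ (suc u)))) 2^1+k≤)
  block : ½ ℚ.≤ sum (suc u) (λ i → inv (suc (u ℕ.+ i)))
  block = begin
    ½
      ≡⟨ fromℕ*inv u 1 ⟨
    fromℕ (suc u) * inv (u ℕ.+ 1 ℕ.* suc u)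
      ≡⟨ sum-const (suc u) _ ⟨
    sum (suc u) (λ _ → inv (u ℕ.+ 1 ℕ.* suc u))
      ≤⟨ sum-mono-≤ (suc u) (λ i i≤u → inv-anti-≤ (ℕ.≤-trans (ℕ.≤-reflexive (sym (ℕ.+-suc u i)))
           (ℕ.+-monoʳ-≤ u (ℕ.≤-trans i≤u (ℕ.≤-reflexive (sym (ℕ.+-identityʳ (suc u)))))))) ⟩
    sum (suc u) (λ i → inv (suc (u ℕ.+ i))) ∎
  tail≥0 : 0ℚ ℚ.≤ sum (t ℕ.∸ v) (λ i → inv (suc (v ℕ.+ i)))
  tail≥0 = sum-nonNeg (t ℕ.∸ v) (λ i → ℚ.<⇒≤ (inv-pos (suc (v ℕ.+ i))))

-- With steps of length 1 the right-endpoint sum is the harmonic sum, and refining the mesh can only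
-- raise it. The bound thus holds for every approximant, with no passage to the limit.
ln-approx-lower : ∀ k δ m → 2 ^ k ≤ suc δ → fromℕ k * ½ ℚ.≤ ln-approx δ m
ln-approx-lower k δ m 2^k≤ = begin
  fromℕ k * ½                       ≤⟨ harmonic-lower k δ 2^k≤ ⟩
  sum δ (λ i → inv (suc i))         ≡⟨ cong (λ l → sum l (λ i → inv (suc i))) (ℕ.*-identityʳ δ) ⟨
  ln-approx δ 0                     ≤⟨ ln-approx-refine-≥ δ 0 m ⟩
  ln-approx δ (m ℕ.+ 0)             ≡⟨ cong (ln-approx δ) (ℕ.+-identityʳ m) ⟩
  ln-approx δ m                     ∎
  where open ℚ.≤-Reasoning

-- Estimates for powers.

p≤q⇒0≤q-p : ∀ {p q} → p ℚ.≤ q → 0ℚ ℚ.≤ q - p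
p≤q⇒0≤q-p {p} {q} p≤q = subst (ℚ._≤ q - p) (ℚ.+-inverseʳ p) (ℚ.+-monoˡ-≤ (- p) p≤q)

bernoulli : ∀ {y} → 0ℚ ℚ.≤ y → y ℚ.≤ 1ℚ → ∀ n → 1ℚ - fromℕ n * y ℚ.≤ (1ℚ - y) ^ℚ n
bernoulli {y} 0≤y y≤1 zero    = ℚ.≤-reflexive (solve 1 (λ y → con 1ℚ :- con 0ℚ :* y := con 1ℚ) refl y)
bernoulli {y} 0≤y y≤1 (suc n) = begin
  1ℚ - fromℕ (suc n) * y
    ≡⟨ cong (λ z → 1ℚ - z * y) (fromℕ-suc n) ⟩
  1ℚ - (1ℚ + fromℕ n) * y
    ≤⟨ ≤-by (fromℕ n * (y * y)) (*-nonNeg (fromℕ-nonNeg n) (*-nonNeg 0≤y 0≤y))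
         (solve 2 (λ n y → con 1ℚ :- (con 1ℚ :+ n) :* y :+ n :* (y :* y)
           := (con 1ℚ :- y) :* (con 1ℚ :- n :* y)) refl (fromℕ n) y) ⟩
  (1ℚ - y) * (1ℚ - fromℕ n * y)
    ≤⟨ *-monoˡ (1ℚ - y) (p≤q⇒0≤q-p y≤1) (bernoulli 0≤y y≤1 n) ⟩
  (1ℚ - y) * (1ℚ - y) ^ℚ n ∎
  where open ℚ.≤-Reasoning

-- The binomial expansion cut off after its quadratic term. The cubic term dropped in the induction
-- is nonnegative because n(n - 1) is so for natural `n`.
bernoulli₂ : ∀ {y} → 0ℚ ℚ.≤ y → ∀ n →
  1ℚ + fromℕ n * y + ½ * (fromℕ n * (fromℕ n - 1ℚ)) * (y * y) ℚ.≤ (1ℚ + y) ^ℚ n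
bernoulli₂ {y} 0≤y zero    = ℚ.≤-reflexive
  (solve 1 (λ y → con 1ℚ :+ con 0ℚ :* y :+ con ½ :* (con 0ℚ :* (con 0ℚ :- con 1ℚ)) :* (y :* y) := con 1ℚ) refl y)
bernoulli₂ {y} 0≤y (suc n) = begin
  1ℚ + fromℕ (suc n) * y + ½ * (fromℕ (suc n) * (fromℕ (suc n) - 1ℚ)) * (y * y)
    ≡⟨ cong (λ z → 1ℚ + z * y + ½ * (z * (z - 1ℚ)) * (y * y)) (fromℕ-suc n) ⟩
  1ℚ + (1ℚ + N) * y + ½ * ((1ℚ + N) * ((1ℚ + N) - 1ℚ)) * (y * y)
    ≤⟨ ≤-by (½ * (N * (N - 1ℚ)) * (y * (y * y)))
         (*-nonNeg (*-nonNeg 0≤½ (0≤n[n-1] n)) (*-nonNeg 0≤y (*-nonNeg 0≤y 0≤y)))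
         (solve 2 (λ n y → con 1ℚ :+ (con 1ℚ :+ n) :* y :+ con ½ :* ((con 1ℚ :+ n) :* ((con 1ℚ :+ n) :- con 1ℚ)) :* (y :* y)
             :+ con ½ :* (n :* (n :- con 1ℚ)) :* (y :* (y :* y))
           := (con 1ℚ :+ y) :* (con 1ℚ :+ n :* y :+ con ½ :* (n :* (n :- con 1ℚ)) :* (y :* y))) refl N y) ⟩
  (1ℚ + y) * (1ℚ + N * y + ½ * (N * (N - 1ℚ)) * (y * y))
    ≤⟨ *-monoˡ (1ℚ + y) (ℚ.+-mono-≤ 0≤1 0≤y) (bernoulli₂ 0≤y n) ⟩
  (1ℚ + y) * (1ℚ + y) ^ℚ n ∎
  where
  open ℚ.≤-Reasoning
  N = fromℕ n
  0≤n[n-1] : ∀ n → 0ℚ ℚ.≤ fromℕ n * (fromℕ n - 1ℚ)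
  0≤n[n-1] zero    = ℚ.≤-refl
  0≤n[n-1] (suc n) = *-nonNeg (fromℕ-nonNeg (suc n)) (p≤q⇒0≤q-p (fromℕ-mono-≤ {1} {suc n} (ℕ.s≤s ℕ.z≤n)))

-- (1 + y)ⁿ ≥ 2 by the second-order Bernoulli inequality, while (1 - y²)ⁿ ≤ 1.
1-y^n≤½ : ∀ {y} n → 0ℚ ℚ.≤ y → fromℕ n * y ≡ + 3 / 4 → y ℚ.≤ + 1 / 12 → (1ℚ - y) ^ℚ n ℚ.≤ ½
1-y^n≤½ {y} n 0≤y ny≡¾ y≤ = begin
  (1ℚ - y) ^ℚ n
    ≡⟨ solve 1 (λ z → z := con ½ :* (z :* con (+ 2 / 1))) refl _ ⟩
  ½ * ((1ℚ - y) ^ℚ n * (+ 2 / 1))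
    ≤⟨ *-monoˡ ½ 0≤½ (*-monoˡ _ (^ℚ-nonNeg n 0≤1-y) 2≤) ⟩
  ½ * ((1ℚ - y) ^ℚ n * (1ℚ + y) ^ℚ n)
    ≡⟨ cong (½ *_) (^-distrib-* (1ℚ - y) (1ℚ + y) n) ⟨
  ½ * ((1ℚ - y) * (1ℚ + y)) ^ℚ n
    ≤⟨ *-monoˡ ½ 0≤½ (^ℚ-mono-≤ n (*-nonNeg 0≤1-y (ℚ.+-mono-≤ 0≤1 0≤y)) 1-y²≤1) ⟩
  ½ * 1ℚ ^ℚ n
    ≡⟨ cong (½ *_) (1^ℚ n) ⟩
  ½ ∎
  where
  open ℚ.≤-Reasoning
  0≤1-y : 0ℚ ℚ.≤ 1ℚ - y
  0≤1-y = p≤q⇒0≤q-p (ℚ.≤-trans y≤ (from-yes (+ 1 / 12 ℚ.≤? 1ℚ)))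
  1-y²≤1 : (1ℚ - y) * (1ℚ + y) ℚ.≤ 1ℚ
  1-y²≤1 = ≤-by (y * y) (*-nonNeg 0≤y 0≤y)
    (solve 1 (λ y → (con 1ℚ :- y) :* (con 1ℚ :+ y) :+ y :* y := con 1ℚ) refl y)
  -- For ny = 3/4 the second-order bound is 65/32 - (3/8)y, which reaches 2 exactly when y ≤ 1/12.
  2≤ : + 2 / 1 ℚ.≤ (1ℚ + y) ^ℚ n
  2≤ = begin
    + 2 / 1
      ≤⟨ ≤-by ((+ 3 / 8) * (+ 1 / 12 - y)) (*-nonNeg (from-yes (0ℚ ℚ.≤? + 3 / 8)) (p≤q⇒0≤q-p y≤))
           (solve 1 (λ y → con (+ 2 / 1) :+ con (+ 3 / 8) :* (con (+ 1 / 12) :- y)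
             := con 1ℚ :+ con (+ 3 / 4) :+ con ½ :* (con (+ 3 / 4) :* (con (+ 3 / 4) :- y))) refl y) ⟩
    1ℚ + + 3 / 4 + ½ * ((+ 3 / 4) * ((+ 3 / 4) - y))
      ≡⟨ cong (λ z → 1ℚ + z + ½ * (z * (z - y))) ny≡¾ ⟨
    1ℚ + fromℕ n * y + ½ * (fromℕ n * y * (fromℕ n * y - y))
      ≡⟨ solve 2 (λ n y → con 1ℚ :+ n :* y :+ con ½ :* (n :* y :* (n :* y :- y))
           := con 1ℚ :+ n :* y :+ con ½ :* (n :* (n :- con 1ℚ)) :* (y :* y)) refl (fromℕ n) y ⟩
    1ℚ + fromℕ n * y + ½ * (fromℕ n * (fromℕ n - 1ℚ)) * (y * y)
      ≤⟨ bernoulli₂ 0≤y n ⟩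
    (1ℚ + y) ^ℚ n ∎

-- Going from m to m + 1 multiplies m zᵐ by (m+1)z/m, at most 1 as soon as (m+1)(1 - z) ≥ 1. This
-- covers the vertices whose degree exceeds the minimum.
m*z^m-anti : ∀ {z} d → 0ℚ ℚ.≤ z → 1ℚ ℚ.≤ fromℕ d * (1ℚ - z) → ∀ j →
  fromℕ (d ℕ.+ j) * z ^ℚ (d ℕ.+ j) ℚ.≤ fromℕ d * z ^ℚ d
m*z^m-anti d 0≤z 1≤ zero rewrite ℕ.+-identityʳ d = ℚ.≤-refl
m*z^m-anti {z} d 0≤z 1≤ (suc j) rewrite ℕ.+-suc d j = begin
  fromℕ (suc m) * (z * z ^ℚ m)
    ≡⟨ cong (_* (z * z ^ℚ m)) (fromℕ-suc m) ⟩
  (1ℚ + fromℕ m) * (z * z ^ℚ m)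
    ≡⟨ ℚ.*-assoc (1ℚ + fromℕ m) z (z ^ℚ m) ⟨
  (1ℚ + fromℕ m) * z * z ^ℚ m
    ≤⟨ *-monoʳ (z ^ℚ m) (^ℚ-nonNeg m 0≤z) step ⟩
  fromℕ m * z ^ℚ m
    ≤⟨ m*z^m-anti d 0≤z 1≤ j ⟩
  fromℕ d * z ^ℚ d ∎
  where
  open ℚ.≤-Reasoning
  m = d ℕ.+ j
  -- Otherwise d(1 - z) would be at most 0, against the hypothesis.
  0≤1-z : 0ℚ ℚ.≤ 1ℚ - z
  0≤1-z = ℚ.≮⇒≥ λ 1-z<0 → ℚ.<-irrefl refl (ℚ.<-≤-trans (ℚ.positive⁻¹ 1ℚ) (ℚ.≤-trans 1≤
    (subst (fromℕ d * (1ℚ - z) ℚ.≤_) (ℚ.*-zeroʳ (fromℕ d)) (*-monoˡ (fromℕ d) (fromℕ-nonNeg d) (ℚ.<⇒≤ 1-z<0)))))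
  step : (1ℚ + fromℕ m) * z ℚ.≤ fromℕ m
  step = begin
    (1ℚ + fromℕ m) * z
      ≤⟨ ≤-by (fromℕ m * (1ℚ - z) - 1ℚ + (1ℚ - z))
           (ℚ.+-mono-≤ (p≤q⇒0≤q-p (ℚ.≤-trans 1≤ (*-monoʳ (1ℚ - z) 0≤1-z (fromℕ-mono-≤ (ℕ.m≤m+n d j))))) 0≤1-z)
           (solve 2 (λ m z → (con 1ℚ :+ m) :* z :+ (m :* (con 1ℚ :- z) :- con 1ℚ :+ (con 1ℚ :- z)) := m) refl (fromℕ m) z) ⟩
    fromℕ m ∎

sq-cancel-≤ : ∀ {p q} → 0ℚ ℚ.≤ q → sq p ℚ.≤ sq q → p ℚ.≤ q
sq-cancel-≤ {p} {q} 0≤q p²≤q² = ℚ.≮⇒≥ λ q<p → ℚ.<-irrefl refl (begin-strict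
  sq q    ≤⟨ *-monoˡ q 0≤q (ℚ.<⇒≤ q<p) ⟩
  q * p   <⟨ ℚ.*-monoˡ-<-pos p {{ℚ.positive (ℚ.≤-<-trans 0≤q q<p)}} q<p ⟩
  sq p    ≤⟨ p²≤q² ⟩
  sq q    ∎)
  where open ℚ.≤-Reasoning

*-inv : ∀ n → fromℕ (suc n) * inv n ≡ 1ℚ
*-inv n = ℚ.*-inverseʳ (fromℕ (suc n))

fromℕ-2^*½^ : ∀ k → fromℕ (2 ^ k) * ½ ^ℚ k ≡ 1ℚ
fromℕ-2^*½^ zero    = refl
fromℕ-2^*½^ (suc k) = begin
  fromℕ (2 ^ suc k) * (½ * ½ ^ℚ k)              ≡⟨ cong (_* (½ * ½ ^ℚ k)) (fromℕ-* 2 (2 ^ k)) ⟩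
  fromℕ 2 * fromℕ (2 ^ k) * (½ * ½ ^ℚ k)        ≡⟨ solve 2 (λ a b → con (fromℕ 2) :* a :* (con ½ :* b) := a :* b) refl (fromℕ (2 ^ k)) (½ ^ℚ k) ⟩
  fromℕ (2 ^ k) * ½ ^ℚ k                        ≡⟨ fromℕ-2^*½^ k ⟩
  1ℚ                                            ∎
  where open ≡-Reasoning

-- Choice of parameters.

module Parameters (δ : ℕ) (10^6≤δ : 10 ^ 6 ≤ δ) where

  private
    d = suc δ
    D = fromℕ d
    D⁻ = inv δ

    0≤D : 0ℚ ℚ.≤ D
    0≤D = fromℕ-nonNeg d

    0≤D⁻ : 0ℚ ℚ.≤ D⁻
    0≤D⁻ = ℚ.<⇒≤ (inv-pos δ)

  -- Integer parts of the binary logarithm and of the square root keep `ε` rational, so the whole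
  -- probabilistic argument takes place in ℚ.
  log-bracket : ∃[ k ] 2 ^ k ≤ d × d ℕ.< 2 ^ suc k
  log-bracket = bracket (2 ^_) (λ k → ℕ.^-monoʳ-< 2 (ℕ.s≤s (ℕ.s≤s ℕ.z≤n)) (ℕ.n<1+n k)) d (ℕ.s≤s ℕ.z≤n)

  k = proj₁ log-bracket

  sqrt-bracket : ∃[ s ] s ℕ.* s ≤ 3 ℕ.* k ℕ.* d × 3 ℕ.* k ℕ.* d ℕ.< suc s ℕ.* suc s
  sqrt-bracket = bracket (λ s → s ℕ.* s) (λ s → ℕ.*-mono-< (ℕ.n<1+n s) (ℕ.n<1+n s)) (3 ℕ.* k ℕ.* d) ℕ.z≤n

  s = proj₁ sqrt-bracket

  private
    -- From 4 on, 3k stays below 2ᵏ.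
    4≤k : 4 ≤ k
    4≤k = ℕ.≮⇒≥ λ k<4 → ℕ.<-irrefl refl (begin-strict
      10 ^ 6       ≤⟨ 10^6≤δ ⟩
      δ            <⟨ ℕ.n<1+n δ ⟩
      d            <⟨ proj₂ (proj₂ log-bracket) ⟩
      2 ^ suc k    ≤⟨ ℕ.^-monoʳ-≤ 2 k<4 ⟩
      2 ^ 4        ≤⟨ ℕ.m≤m+n 16 (10 ^ 6 ℕ.∸ 16) ⟩
      10 ^ 6       ∎)
      where open ℕ.≤-Reasoning

    3k<2^k : ∀ {k} → 4 ≤ k → 3 ℕ.* k ℕ.< 2 ^ k
    3k<2^k {k} 4≤k = subst (λ k → 3 ℕ.* k ℕ.< 2 ^ k) (ℕ.m+[n∸m]≡n 4≤k) (go (k ℕ.∸ 4))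
      where
      open ℕ.≤-Reasoning
      go : ∀ j → 3 ℕ.* (4 ℕ.+ j) ℕ.< 2 ^ (4 ℕ.+ j)
      go zero    = ℕ.m≤m+n 13 3
      go (suc j) = begin-strict
        3 ℕ.* (4 ℕ.+ suc j)                    ≡⟨ cong (3 ℕ.*_) (ℕ.+-suc 4 j) ⟩
        3 ℕ.* suc (4 ℕ.+ j)                    ≡⟨ ℕ.*-suc 3 (4 ℕ.+ j) ⟩
        3 ℕ.+ 3 ℕ.* (4 ℕ.+ j)                  <⟨ ℕ.+-mono-≤-< (ℕ.≤-trans (ℕ.m≤m*n 3 (4 ℕ.+ j)) (ℕ.<⇒≤ (go j))) (go j) ⟩
        2 ^ (4 ℕ.+ j) ℕ.+ 2 ^ (4 ℕ.+ j)        ≡⟨ cong (2 ^ (4 ℕ.+ j) ℕ.+_) (ℕ.+-identityʳ _) ⟨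
        2 ^ suc (4 ℕ.+ j)                      ≡⟨ cong (2 ^_) (ℕ.+-suc 4 j) ⟨
        2 ^ (4 ℕ.+ suc j)                      ∎

    -- If d ≤ s, then d² ≤ s² ≤ 3kd, hence d ≤ 3k < 2ᵏ ≤ d. This gives ε ≤ 1, so that (1 - ε)/2 is a
    -- probability.
    s<d : s ℕ.< d
    s<d = ℕ.≰⇒> λ d≤s → ℕ.<⇒≱ (ℕ.<-≤-trans (3k<2^k 4≤k) (proj₁ (proj₂ log-bracket)))
      (ℕ.*-cancelʳ-≤ d (3 ℕ.* k) d (ℕ.≤-trans (ℕ.*-mono-≤ d≤s d≤s) (proj₁ (proj₂ sqrt-bracket))))

    K = fromℕ k

    fromℕ-3kd : fromℕ (3 ℕ.* k ℕ.* d) ≡ fromℕ 3 * K * D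
    fromℕ-3kd = trans (fromℕ-* (3 ℕ.* k) d) (cong (_* D) (fromℕ-* 3 k))

  ε : ℚ
  ε = fromℕ (suc s) * D⁻

  0≤ε : 0ℚ ℚ.≤ ε
  0≤ε = *-nonNeg (fromℕ-nonNeg (suc s)) 0≤D⁻

  ε≤1 : ε ℚ.≤ 1ℚ
  ε≤1 = subst (ε ℚ.≤_) (*-inv δ) (*-monoʳ D⁻ 0≤D⁻ (fromℕ-mono-≤ s<d))

  -- The reason for `suc s` in `ε`: rounding the root of 3kd up keeps ε² from falling below 3k/d.
  3kD⁻≤ε² : fromℕ 3 * K * D⁻ ℚ.≤ ε * ε
  3kD⁻≤ε² = begin
    fromℕ 3 * K * D⁻                      ≡⟨ ℚ.*-identityʳ _ ⟨
    fromℕ 3 * K * D⁻ * 1ℚ                 ≡⟨ cong (fromℕ 3 * K * D⁻ *_) (*-inv δ) ⟨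
    fromℕ 3 * K * D⁻ * (D * D⁻)           ≡⟨ solve 3 (λ a d i → a :* i :* (d :* i) := a :* d :* (i :* i)) refl (fromℕ 3 * K) D D⁻ ⟩
    fromℕ 3 * K * D * (D⁻ * D⁻)           ≡⟨ cong (_* (D⁻ * D⁻)) fromℕ-3kd ⟨
    fromℕ (3 ℕ.* k ℕ.* d) * (D⁻ * D⁻)     ≤⟨ *-monoʳ (D⁻ * D⁻) (*-nonNeg 0≤D⁻ 0≤D⁻) (fromℕ-mono-≤ (ℕ.<⇒≤ (proj₂ (proj₂ sqrt-bracket)))) ⟩
    fromℕ (suc s ℕ.* suc s) * (D⁻ * D⁻)   ≡⟨ cong (_* (D⁻ * D⁻)) (fromℕ-* (suc s) (suc s)) ⟩
    S * S * (D⁻ * D⁻)                     ≡⟨ solve 2 (λ s i → s :* s :* (i :* i) := s :* i :* (s :* i)) refl S D⁻ ⟩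
    ε * ε                                 ∎
    where
    open ℚ.≤-Reasoning
    S = fromℕ (suc s)

  private
    x = ½ * (ε * ε)
    -- Chosen so that 2ky = 3k/(2d), which is at most `x`, while dy = 3/4 is the value required by
    -- `1-y^n≤½`.
    y = (+ 3 / 4) * D⁻

    0≤1-x : 0ℚ ℚ.≤ 1ℚ - x
    0≤1-x = p≤q⇒0≤q-p (ℚ.≤-trans (*-monoˡ ½ 0≤½ (*-mono-≤ 0≤ε 0≤1 ε≤1 ε≤1)) (from-yes (½ * (1ℚ * 1ℚ) ℚ.≤? 1ℚ)))

    2ky≤x : fromℕ (2 ℕ.* k) * y ℚ.≤ x
    2ky≤x = subst (ℚ._≤ x) (begin
      ½ * (fromℕ 3 * K * D⁻)                ≡⟨ solve 2 (λ k i → con ½ :* (con (fromℕ 3) :* k :* i) := con (fromℕ 2) :* k :* (con (+ 3 / 4) :* i)) refl K D⁻ ⟩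
      fromℕ 2 * K * y                       ≡⟨ cong (_* y) (fromℕ-* 2 k) ⟨
      fromℕ (2 ℕ.* k) * y                   ∎)
      (*-monoˡ ½ 0≤½ 3kD⁻≤ε²)
      where open ≡-Reasoning

    0≤y : 0ℚ ℚ.≤ y
    0≤y = *-nonNeg (from-yes (0ℚ ℚ.≤? + 3 / 4)) 0≤D⁻

    Dy≡¾ : D * y ≡ + 3 / 4
    Dy≡¾ = trans (solve 3 (λ d c i → d :* (c :* i) := c :* (d :* i)) refl D (+ 3 / 4) D⁻)
        (trans (cong ((+ 3 / 4) *_) (*-inv δ)) (ℚ.*-identityʳ (+ 3 / 4)))

    y≤1/12 : y ℚ.≤ + 1 / 12
    y≤1/12 = ℚ.≤-trans
      -- `inv 8` is 1/9, and 3/4 of it is 1/12.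
      (*-monoˡ (+ 3 / 4) (from-yes (0ℚ ℚ.≤? + 3 / 4)) (inv-anti-≤ {8} {δ} (ℕ.≤-trans (ℕ.m≤m+n 8 (10 ^ 6 ℕ.∸ 8)) 10^6≤δ)))
      (from-yes ((+ 3 / 4) * inv 8 ℚ.≤? + 1 / 12))

    -- The condition of `m*z^m-anti` for z = 1 - x, written in its form: dx ≥ 2k · dy = 2k · 3/4 ≥
    -- 3/2.
    1≤D*x : 1ℚ ℚ.≤ D * (1ℚ - (1ℚ - x))
    1≤D*x = begin
      1ℚ
        ≤⟨ from-yes (1ℚ ℚ.≤? fromℕ 2 * (+ 3 / 4)) ⟩
      fromℕ 2 * (+ 3 / 4)
        ≤⟨ *-monoʳ (+ 3 / 4) (from-yes (0ℚ ℚ.≤? + 3 / 4)) (fromℕ-mono-≤ {2} {2 ℕ.* k} (ℕ.*-monoʳ-≤ 2 (ℕ.≤-trans (ℕ.s≤s ℕ.z≤n) 4≤k))) ⟩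
      fromℕ (2 ℕ.* k) * (+ 3 / 4)
        ≡⟨ cong (fromℕ (2 ℕ.* k) *_) Dy≡¾ ⟨
      fromℕ (2 ℕ.* k) * (D * y)
        ≡⟨ solve 3 (λ a d y → a :* (d :* y) := d :* (a :* y)) refl (fromℕ (2 ℕ.* k)) D y ⟩
      D * (fromℕ (2 ℕ.* k) * y)
        ≤⟨ *-monoˡ D 0≤D 2ky≤x ⟩
      D * x
        ≡⟨ solve 2 (λ d x → d :* x := d :* (con 1ℚ :- (con 1ℚ :- x))) refl D x ⟩
      D * (1ℚ - (1ℚ - x)) ∎
      where open ℚ.≤-Reasoning

    D*½^k≤2 : D * ½ ^ℚ k ℚ.≤ fromℕ 2
    D*½^k≤2 = begin
      D * ½ ^ℚ k                        ≤⟨ *-monoʳ (½ ^ℚ k) (^ℚ-nonNeg k 0≤½) (fromℕ-mono-≤ (ℕ.<⇒≤ (proj₂ (proj₂ log-bracket)))) ⟩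
      fromℕ (2 ^ suc k) * ½ ^ℚ k        ≡⟨ cong (_* ½ ^ℚ k) (fromℕ-* 2 (2 ^ k)) ⟩
      fromℕ 2 * fromℕ (2 ^ k) * ½ ^ℚ k  ≡⟨ ℚ.*-assoc (fromℕ 2) (fromℕ (2 ^ k)) (½ ^ℚ k) ⟩
      fromℕ 2 * (fromℕ (2 ^ k) * ½ ^ℚ k) ≡⟨ cong (fromℕ 2 *_) (fromℕ-2^*½^ k) ⟩
      fromℕ 2 * 1ℚ                      ≡⟨ ℚ.*-identityʳ (fromℕ 2) ⟩
      fromℕ 2                           ∎
      where open ℚ.≤-Reasoning

    -- Bernoulli trades 1 - x for (1 - y)²ᵏ. Exchanging the two exponents then brings out (1 - y)ᵈ,
    -- which is at most 1/2, raised to the power 2k.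
    [1-x]^d≤ : (1ℚ - x) ^ℚ d ℚ.≤ ½ ^ℚ k * ½ ^ℚ k
    [1-x]^d≤ = begin
      (1ℚ - x) ^ℚ d                    ≤⟨ ^ℚ-mono-≤ d 0≤1-x (ℚ.≤-trans (ℚ.+-monoʳ-≤ 1ℚ (ℚ.neg-antimono-≤ 2ky≤x))
                                            (bernoulli 0≤y (ℚ.≤-trans y≤1/12 (from-yes (+ 1 / 12 ℚ.≤? 1ℚ))) (2 ℕ.* k))) ⟩
      ((1ℚ - y) ^ℚ (2 ℕ.* k)) ^ℚ d     ≡⟨ ^-assocʳ (1ℚ - y) (2 ℕ.* k) d ⟩
      (1ℚ - y) ^ℚ (2 ℕ.* k ℕ.* d)      ≡⟨ cong ((1ℚ - y) ^ℚ_) (ℕ.*-comm (2 ℕ.* k) d) ⟩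
      (1ℚ - y) ^ℚ (d ℕ.* (2 ℕ.* k))    ≡⟨ ^-assocʳ (1ℚ - y) d (2 ℕ.* k) ⟨
      ((1ℚ - y) ^ℚ d) ^ℚ (2 ℕ.* k)     ≤⟨ ^ℚ-mono-≤ (2 ℕ.* k) (^ℚ-nonNeg d 0≤1-y) (1-y^n≤½ d 0≤y Dy≡¾ y≤1/12) ⟩
      ½ ^ℚ (2 ℕ.* k)                   ≡⟨ cong (λ l → ½ ^ℚ (k ℕ.+ l)) (ℕ.+-identityʳ k) ⟩
      ½ ^ℚ (k ℕ.+ k)                   ≡⟨ ^-homo-* ½ k k ⟩
      ½ ^ℚ k * ½ ^ℚ k                  ∎
      where
      open ℚ.≤-Reasoning
      0≤1-y : 0ℚ ℚ.≤ 1ℚ - y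
      0≤1-y = p≤q⇒0≤q-p (ℚ.≤-trans y≤1/12 (from-yes (+ 1 / 12 ℚ.≤? 1ℚ)))

  repair-cost-≤ : ∀ m → d ≤ m → fromℕ (2 ℕ.* m) * (1ℚ - ½ * (ε * ε)) ^ℚ m ℚ.≤ fromℕ 8 * inv δ
  repair-cost-≤ m d≤m = begin
    fromℕ (2 ℕ.* m) * (1ℚ - x) ^ℚ m
      ≡⟨ trans (cong (_* (1ℚ - x) ^ℚ m) (fromℕ-* 2 m)) (ℚ.*-assoc (fromℕ 2) (fromℕ m) ((1ℚ - x) ^ℚ m)) ⟩
    fromℕ 2 * (fromℕ m * (1ℚ - x) ^ℚ m)
      ≤⟨ *-monoˡ (fromℕ 2) 0≤2 (subst (λ m → fromℕ m * (1ℚ - x) ^ℚ m ℚ.≤ D * (1ℚ - x) ^ℚ d)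
           (ℕ.m+[n∸m]≡n d≤m) (m*z^m-anti d 0≤1-x 1≤D*x (m ℕ.∸ d))) ⟩
    fromℕ 2 * (D * (1ℚ - x) ^ℚ d)
      ≤⟨ *-monoˡ (fromℕ 2) 0≤2 (*-monoˡ D 0≤D [1-x]^d≤) ⟩
    fromℕ 2 * (D * (h * h))
      -- A factor d · (1/d) is inserted to square d/2ᵏ, which is at most 2. The cost becomes
      -- 2(d/2ᵏ)²/d ≤ 8/d.
      ≡⟨ solve 2 (λ d h → con (fromℕ 2) :* (d :* (h :* h)) := con (fromℕ 2) :* (d :* h :* h :* con 1ℚ)) refl D h ⟩
    fromℕ 2 * (D * h * h * 1ℚ)
      ≡⟨ cong (λ z → fromℕ 2 * (D * h * h * z)) (*-inv δ) ⟨
    fromℕ 2 * (D * h * h * (D * D⁻))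
      ≡⟨ solve 3 (λ d h i → con (fromℕ 2) :* (d :* h :* h :* (d :* i)) := con (fromℕ 2) :* (d :* h :* (d :* h)) :* i) refl D h D⁻ ⟩
    fromℕ 2 * (D * h * (D * h)) * D⁻
      ≤⟨ *-monoʳ D⁻ 0≤D⁻ (*-monoˡ (fromℕ 2) 0≤2 (*-mono-≤ (*-nonNeg 0≤D (^ℚ-nonNeg k 0≤½)) 0≤2 D*½^k≤2 D*½^k≤2)) ⟩
    fromℕ 2 * (fromℕ 2 * fromℕ 2) * D⁻
      ≡⟨⟩
    fromℕ 8 * inv δ ∎
    where
    open ℚ.≤-Reasoning
    h = ½ ^ℚ k
    0≤2 : 0ℚ ℚ.≤ fromℕ 2
    0≤2 = fromℕ-nonNeg 2

  γₛ-≤ : ∀ {n} (G : Graph n) → (∀ v → δ ≤ degree G v) → fromℤ (γₛ G) ℚ.≤ fromℕ n * (ε + fromℕ 8 * inv δ)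
  γₛ-≤ G δ≤deg = γₛ-bound G ε (fromℕ 8 * inv δ) 0≤ε ε≤1 λ v →
    repair-cost-≤ (length (N[_] G v)) (ℕ.≤-trans (ℕ.s≤s (δ≤deg v)) (degree<∣N∣ G v))

  -- q and r stand for rational approximations of √ (6 ln (δ + 1)) and √ (δ + 1).
  rate-≤ : ∀ {q r i} → 0ℚ ℚ.≤ q → 0ℚ ℚ.≤ r → 0ℚ ℚ.≤ i → i ℚ.≤ 1ℚ → fromℕ 3 * K ℚ.≤ sq (q + i) → sq r ℚ.≤ D →
    (ε + fromℕ 8 * inv δ) * r ℚ.≤ q + + 121 / 100
  rate-≤ {q} {r} {i} 0≤q 0≤r 0≤i i≤1 3k≤ r²≤D = begin
    (fromℕ (suc s) * D⁻ + fromℕ 8 * D⁻) * r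
      ≡⟨ cong (λ z → (z * D⁻ + fromℕ 8 * D⁻) * r) (fromℕ-suc s) ⟩
    ((1ℚ + S) * D⁻ + fromℕ 8 * D⁻) * r
      -- The 9 collects the 8 of the repair cost and the 1 from rounding `s` up. Written as (9/1000)
      -- · 1000r it costs only 9/1000 in the end.
      ≡⟨ solve 3 (λ s i r → ((con 1ℚ :+ s) :* i :+ con (fromℕ 8) :* i) :* r
           := (s :* r :+ con (+ 9 / 1000) :* (con (fromℕ 1000) :* r)) :* i) refl S D⁻ r ⟩
    (S * r + (+ 9 / 1000) * (fromℕ 1000 * r)) * D⁻
      ≤⟨ *-monoʳ D⁻ 0≤D⁻ (ℚ.+-mono-≤ Sr≤ (*-monoˡ (+ 9 / 1000) (from-yes (0ℚ ℚ.≤? + 9 / 1000)) 1000r≤D)) ⟩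
    ((q + 1ℚ) * D + (+ 9 / 1000) * D) * D⁻
      ≡⟨ solve 3 (λ q d i → ((q :+ con 1ℚ) :* d :+ con (+ 9 / 1000) :* d) :* i
           := (q :+ (con 1ℚ :+ con (+ 9 / 1000))) :* (d :* i)) refl q D D⁻ ⟩
    (q + (1ℚ + + 9 / 1000)) * (D * D⁻)
      ≡⟨ trans (cong ((q + (1ℚ + + 9 / 1000)) *_) (*-inv δ)) (ℚ.*-identityʳ _) ⟩
    q + (1ℚ + + 9 / 1000)
      ≤⟨ ℚ.+-monoʳ-≤ q (from-yes (1ℚ + + 9 / 1000 ℚ.≤? + 121 / 100)) ⟩
    q + + 121 / 100 ∎
    where
    open ℚ.≤-Reasoning
    S = fromℕ s
    -- The summand 1 is a crude bound for the error `i` of the root, valid at every index. With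
    -- 9/1000 it makes 1.009, within 1.21.
    Sr≤ : S * r ℚ.≤ (q + 1ℚ) * D
    Sr≤ = sq-cancel-≤ (*-nonNeg (ℚ.+-mono-≤ 0≤q 0≤1) 0≤D) (begin
      sq (S * r)
        ≡⟨ solve 2 (λ s r → s :* r :* (s :* r) := s :* s :* (r :* r)) refl S r ⟩
      S * S * sq r
        ≤⟨ *-mono-≤ (*-nonNeg (fromℕ-nonNeg s) (fromℕ-nonNeg s)) 0≤D
             (subst (ℚ._≤ fromℕ (3 ℕ.* k ℕ.* d)) (fromℕ-* s s) (fromℕ-mono-≤ (proj₁ (proj₂ sqrt-bracket)))) r²≤D ⟩
      fromℕ (3 ℕ.* k ℕ.* d) * D
        ≡⟨ cong (_* D) fromℕ-3kd ⟩
      fromℕ 3 * K * D * D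
        ≡⟨ ℚ.*-assoc (fromℕ 3 * K) D D ⟩
      fromℕ 3 * K * (D * D)
        ≤⟨ *-monoʳ (D * D) (*-nonNeg 0≤D 0≤D) (ℚ.≤-trans 3k≤ (sq-mono-≤ (ℚ.+-mono-≤ 0≤q 0≤i) (ℚ.+-monoʳ-≤ q i≤1))) ⟩
      sq (q + 1ℚ) * (D * D)
        ≡⟨ solve 2 (λ s d → s :* s :* (d :* d) := s :* d :* (s :* d)) refl (q + 1ℚ) D ⟩
      sq ((q + 1ℚ) * D) ∎)
    -- Here 10⁶ enters as 1000²: (1000r)² ≤ 10⁶ d ≤ d².
    1000r≤D : fromℕ 1000 * r ℚ.≤ D
    1000r≤D = sq-cancel-≤ 0≤D (begin
      sq (fromℕ 1000 * r)
        ≡⟨ solve 1 (λ r → con (fromℕ 1000) :* r :* (con (fromℕ 1000) :* r) := con (fromℕ (10 ^ 6)) :* (r :* r)) refl r ⟩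
      fromℕ (10 ^ 6) * sq r
        ≤⟨ *-mono-≤ (fromℕ-nonNeg (10 ^ 6)) 0≤D (fromℕ-mono-≤ (ℕ.m≤n⇒m≤1+n 10^6≤δ)) r²≤D ⟩
      D * D ∎)

-- Transfer to the real numbers.

-- From the threshold on, the maximum inside the reciprocal equals `seq y n`, so the division there
-- is the ordinary one of rationals.
÷ᴿ-lower : ∀ c x y {{y>0 : Positive y}} n → threshold y>0 ≤ n → c * seq y n ℚ.≤ seq x n → c ℚ.≤ seq (x ÷ᴿ y) n
÷ᴿ-lower c x y {{y>0}} n N≤n c*y≤x = begin
  c                             ≡⟨ ℚ.*-identityʳ c ⟨
  c * 1ℚ                        ≡⟨ cong (c *_) (*-recip z 0<z) ⟨
  c * (z * recip z 0<z)         ≡⟨ ℚ.*-assoc c z (recip z 0<z) ⟨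
  c * z * recip z 0<z           ≡⟨ cong (λ w → c * w * recip z 0<z) (ℚ.p≥q⇒p⊔q≡p (bounds y>0 n N≤n)) ⟩
  c * seq y n * recip z 0<z     ≤⟨ *-monoʳ (recip z 0<z) (ℚ.<⇒≤ (recip-pos z 0<z)) c*y≤x ⟩
  seq (x ÷ᴿ y) n                ∎
  where
  open ℚ.≤-Reasoning
  z = seq y n ℚ.⊔ bound y>0
  0<z = ⊔-pos (seq y n) (bound>0 y>0)

≤ᴿ-eventually : ∀ {x y} N → (∀ n → N ≤ n → seq x n ℚ.≤ seq y n) → x ≤ᴿ y
≤ᴿ-eventually {y = y} N x≤y ε 0<ε = N , λ n N≤n → ℚ.≤-trans (x≤y n N≤n) (≤-by {seq y n} ε (ℚ.<⇒≤ 0<ε) refl)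

theorem5 : ∀ (n : ℕ) (G : Graph n) (δ : ℕ) → IsMinDegree G δ → 10 ^ 6 ≤ δ →
    fromℤᴿ (γₛ G) ≤ᴿ
    (√ (fromℕᴿ 6 *ᴿ ln (suc δ)) +ᴿ fromℚ (+ 121 / 100)) ÷ᴿ √ (fromℕᴿ (suc δ)) *ᴿ fromℕᴿ n
theorem5 n G δ (δ≤deg , _) 10^6≤δ = ≤ᴿ-eventually {x = fromℤᴿ (γₛ G)} {y = numerator ÷ᴿ √ (fromℕᴿ (suc δ)) *ᴿ fromℕᴿ n} (threshold √d>0) λ m N≤m → begin
  fromℤ (γₛ G)
    ≤⟨ γₛ-≤ G δ≤deg ⟩
  fromℕ n * rate
    ≡⟨ ℚ.*-comm (fromℕ n) rate ⟩
  rate * fromℕ n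
    ≤⟨ *-monoʳ (fromℕ n) (fromℕ-nonNeg n)
         (÷ᴿ-lower rate numerator (√ (fromℕᴿ (suc δ))) m N≤m (at m)) ⟩
  seq (numerator ÷ᴿ √ (fromℕᴿ (suc δ)) *ᴿ fromℕᴿ n) m ∎
  where
  open ℚ.≤-Reasoning
  open Parameters δ 10^6≤δ
  rate = ε + fromℕ 8 * inv δ
  numerator = √ (fromℕᴿ 6 *ᴿ ln (suc δ)) +ᴿ fromℚ (+ 121 / 100)
  -- The instance that the division resolves to, named so that its threshold can serve as the
  -- starting index.
  √d>0 : Positive (√ (fromℕᴿ (suc δ)))
  √d>0 = √-positive
  at : ∀ m → rate * seq (√ (fromℕᴿ (suc δ))) m ℚ.≤ seq (√ (fromℕᴿ 6 *ᴿ ln (suc δ))) m + + 121 / 100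
  at m = rate-≤ (√-approx-nonNeg m (a ℚ.⊔ 0ℚ)) (√-approx-nonNeg m (fromℕ (suc δ) ℚ.⊔ 0ℚ)) (ℚ.<⇒≤ (inv-pos m))
    -- `inv 0` is 1, which bounds the error `inv m` of the root at every index.
    (inv-anti-≤ {0} {m} ℕ.z≤n) 3k≤
    (ℚ.≤-trans (√-approx-lower m (0≤p⊔0 (fromℕ (suc δ)))) (ℚ.≤-reflexive (ℚ.p≥q⇒p⊔q≡p (fromℕ-nonNeg (suc δ)))))
    where
    a = fromℕ 6 * ln-approx δ m
    3k≤ : fromℕ 3 * fromℕ k ℚ.≤ sq (√-approx m (a ℚ.⊔ 0ℚ) + inv m)
    3k≤ = begin
      fromℕ 3 * fromℕ k
        ≡⟨ solve 1 (λ k → con (fromℕ 3) :* k := con (fromℕ 6) :* (k :* con ½)) refl (fromℕ k) ⟩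
      fromℕ 6 * (fromℕ k * ½)
        ≤⟨ *-monoˡ (fromℕ 6) (fromℕ-nonNeg 6) (ln-approx-lower k δ m (proj₁ (proj₂ log-bracket))) ⟩
      a
        ≤⟨ ℚ.p≤p⊔q a 0ℚ ⟩
      a ℚ.⊔ 0ℚ
        <⟨ √-approx-upper m (0≤p⊔0 a) ⟩
      sq (√-approx m (a ℚ.⊔ 0ℚ) + inv m) ∎
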